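{- For every natural number $k\ge 2$, the class $\mathcal{H}_k$ is closed under taking minors: if $H\in\mathcal{H}_k$ and $G$ is a minor of $H$, then $G\in\mathcal{H}_k$.
   Context: All graphs are finite; parallel edges are allowed, loops are not. A length-function on a graph $G$ is a map $\ell:E(G)\to\mathbb{R}^+$ (strictly positive reals); $\ell(H)=\sum_{e\in E(H)}\ell(e)$ for subgraphs $H$, which carry the restricted length-function. $\mathrm{sd}_G(A)$ is the minimum of $\ell(S)$ over connected subgraphs $S\subseteq G$ with $A\subseteq V(S)$ ($\infty$ if none). $H\subseteq G$ is $k$-geodesic in $G$ if $\mathrm{sd}_H(A)=\mathrm{sd}_G(A)$ for all $A\subseteq V(H)$ with $|A|\le k$, and fully geodesic if it is $k$-geodesic for all $k$. For $k\ge2$, $\mathcal{H}_k$ is the class of all graphs $H$ such that for every graph $G\supseteq H$ and every length-function on $G$ for which $H$ is $k$-geodesic in $G$, $H$ is fully geodesic in $G$. -}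

module Defs where

open import Data.Fin using (Fin; _≟_)
open import Data.Fin.Properties using (any?; all?)
open import Data.Fin.Subset using (Subset; inside; outside; _∈_; _⊆_; Nonempty; ∣_∣)
open import Data.Fin.Subset.Properties using (_∈?_; _⊆?_; nonempty?)
open import Data.List using (List; []; _∷_; map; foldr; filter; allFin; cartesianProduct; _++_)
open import Data.List.Membership.Propositional using (find; lose)
open import Data.List.Membership.Propositional.Properties using (∈-filter⁺; ∈-filter⁻; ∈-allFin)
open import Data.List.Relation.Unary.Any using (Any; here; there)
open import Data.Maybe using (Maybe; just; nothing)
open import Data.Maybe.Relation.Binary.Pointwise using (Pointwise)
open import Data.Nat as ℕ using (ℕ)
import Data.Nat.Properties as ℕₚ
open import Data.Product using (∃; _×_; _,_; proj₁; proj₂)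
open import Data.Rational as ℚ using (ℚ; 0ℚ; ½)
import Data.Rational.Properties as ℚₚ
open import Data.Rational.Solver using (module +-*-Solver)
open import Data.Sum using (_⊎_; inj₁; inj₂)
import Data.Vec as Vec
open import Function using (_∘_)
open import Function.Definitions using (Injective)
open import Relation.Binary.Construct.Closure.ReflexiveTransitive as Star using (Star; ε; _◅_; _◅◅_)
open import Relation.Binary.PropositionalEquality using (_≡_; _≢_; refl; sym; trans; cong; subst; subst₂)
open import Relation.Nullary using (Dec; does)
open import Relation.Nullary.Decidable using (_×-dec_; _⊎-dec_; _→-dec_; map′)
open import Relation.Unary using (Decidable)

-- Real numbers: Cauchy sequences of rationals, with the usual
-- equivalence _≈_ in the role of equality.

Cauchy : (ℕ → ℚ) → Set
Cauchy x = ∀ δ → 0ℚ ℚ.< δ →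
  ∃ λ N → ∀ m n → N ℕ.≤ m → N ℕ.≤ n → ℚ.∣ x m ℚ.- x n ∣ ℚ.< δ

record ℝ : Set where
  constructor mkℝ
  field
    seq    : ℕ → ℚ
    cauchy : Cauchy seq

open ℝ public

infix 4 _≈_ _<_

_≈_ : ℝ → ℝ → Set
x ≈ y = ∀ δ → 0ℚ ℚ.< δ →
  ∃ λ N → ∀ n → N ℕ.≤ n → ℚ.∣ seq x n ℚ.- seq y n ∣ ℚ.< δ

_<_ : ℝ → ℝ → Set
x < y = ∃ λ δ → 0ℚ ℚ.< δ × ∃ λ N → ∀ n → N ℕ.≤ n → seq x n ℚ.+ δ ℚ.≤ seq y n

0ℝ : ℝ
0ℝ = mkℝ (λ _ → 0ℚ) (λ δ 0<δ → 0 , λ _ _ _ _ → 0<δ)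

private
  open +-*-Solver using (solve; _:=_; _:+_; _:-_; :-_)

  half-pos : ∀ {δ} → 0ℚ ℚ.< δ → 0ℚ ℚ.< ½ ℚ.* δ
  half-pos {δ} 0<δ =
    subst (ℚ._< ½ ℚ.* δ) (ℚₚ.*-zeroʳ ½) (ℚₚ.*-monoʳ-<-pos ½ 0<δ)

  half+half : ∀ δ → ½ ℚ.* δ ℚ.+ ½ ℚ.* δ ≡ δ
  half+half δ = trans (sym (ℚₚ.*-distribʳ-+ δ ½ ½)) (ℚₚ.*-identityˡ δ)

  interchange : ∀ a b c d → (a ℚ.- c) ℚ.+ (b ℚ.- d) ≡ (a ℚ.+ b) ℚ.- (c ℚ.+ d)
  interchange = solve 4 (λ a b c d → (a :- c) :+ (b :- d) := (a :+ b) :- (c :+ d)) refl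

  cancel : ∀ p q → (p ℚ.- q) ℚ.+ q ≡ p
  cancel = solve 2 (λ p q → (p :- q) :+ q := p) refl

  cancel′ : ∀ q δ → (δ ℚ.+ q) ℚ.- q ≡ δ
  cancel′ = solve 2 (λ q δ → (δ :+ q) :- q := δ) refl

  neg-diff : ∀ p q → ℚ.- (p ℚ.- q) ≡ q ℚ.- p
  neg-diff = solve 2 (λ p q → :- (p :- q) := q :- p) refl

  p≤∣p∣ : ∀ p → p ℚ.≤ ℚ.∣ p ∣
  p≤∣p∣ p with ℚₚ.≤-total 0ℚ p
  ... | inj₁ 0≤p = ℚₚ.≤-reflexive (sym (ℚₚ.0≤p⇒∣p∣≡p 0≤p))
  ... | inj₂ p≤0 = ℚₚ.≤-trans p≤0 (ℚₚ.0≤∣p∣ p)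

  ∣-∣-comm : ∀ p q → ℚ.∣ p ℚ.- q ∣ ≡ ℚ.∣ q ℚ.- p ∣
  ∣-∣-comm p q =
    trans (sym (ℚₚ.∣-p∣≡∣p∣ (p ℚ.- q))) (cong ℚ.∣_∣ (neg-diff p q))

  close⇒< : ∀ p q {δ} → ℚ.∣ p ℚ.- q ∣ ℚ.< δ → p ℚ.< δ ℚ.+ q
  close⇒< p q {δ} h = subst (ℚ._< δ ℚ.+ q) (cancel p q)
    (ℚₚ.+-monoˡ-< q (ℚₚ.≤-<-trans (p≤∣p∣ (p ℚ.- q)) h))

  <⇒diff< : ∀ {p q δ} → p ℚ.< δ ℚ.+ q → p ℚ.- q ℚ.< δ
  <⇒diff< {p} {q} {δ} h = subst (p ℚ.- q ℚ.<_) (cancel′ q δ) (ℚₚ.+-monoˡ-< (ℚ.- q) h)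

  <⇒close : ∀ {p q δ} → p ℚ.< δ ℚ.+ q → q ℚ.< δ ℚ.+ p → ℚ.∣ p ℚ.- q ∣ ℚ.< δ
  <⇒close {p} {q} {δ} h₁ h₂ with ℚₚ.∣p∣≡p∨∣p∣≡-p (p ℚ.- q)
  ... | inj₁ eq = subst (ℚ._< δ) (sym eq) (<⇒diff< h₁)
  ... | inj₂ eq = subst (ℚ._< δ) (sym (trans eq (neg-diff p q))) (<⇒diff< h₂)

  ⊓-<-shift : ∀ a b c d {δ} → a ℚ.< δ ℚ.+ c → b ℚ.< δ ℚ.+ d → a ℚ.⊓ b ℚ.< δ ℚ.+ (c ℚ.⊓ d)
  ⊓-<-shift a b c d {δ} h₁ h₂ with ℚₚ.⊓-sel c d
  ... | inj₁ eq = subst (λ z → a ℚ.⊓ b ℚ.< δ ℚ.+ z) (sym eq) (ℚₚ.≤-<-trans (ℚₚ.p⊓q≤p a b) h₁)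
  ... | inj₂ eq = subst (λ z → a ℚ.⊓ b ℚ.< δ ℚ.+ z) (sym eq) (ℚₚ.≤-<-trans (ℚₚ.p⊓q≤q a b) h₂)

  ⊓-close : ∀ a b c d {δ} → ℚ.∣ a ℚ.- c ∣ ℚ.< δ → ℚ.∣ b ℚ.- d ∣ ℚ.< δ →
    ℚ.∣ (a ℚ.⊓ b) ℚ.- (c ℚ.⊓ d) ∣ ℚ.< δ
  ⊓-close a b c d {δ} h₁ h₂ = <⇒close
    (⊓-<-shift a b c d {δ} (close⇒< a c h₁) (close⇒< b d h₂))
    (⊓-<-shift c d a b {δ} (close⇒< c a (subst (ℚ._< δ) (∣-∣-comm a c) h₁))
                           (close⇒< d b (subst (ℚ._< δ) (∣-∣-comm b d) h₂)))

  +-close : ∀ a b c d {δ} → ℚ.∣ a ℚ.- c ∣ ℚ.< ½ ℚ.* δ → ℚ.∣ b ℚ.- d ∣ ℚ.< ½ ℚ.* δ →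
    ℚ.∣ (a ℚ.+ b) ℚ.- (c ℚ.+ d) ∣ ℚ.< δ
  +-close a b c d {δ} h₁ h₂ =
    subst₂ ℚ._<_ (cong ℚ.∣_∣ (interchange a b c d)) (half+half δ)
      (ℚₚ.≤-<-trans (ℚₚ.∣p+q∣≤∣p∣+∣q∣ (a ℚ.- c) (b ℚ.- d)) (ℚₚ.+-mono-< h₁ h₂))

infixl 6 _+_
infixl 7 _⊓_

_+_ : ℝ → ℝ → ℝ
seq (x + y) n = seq x n ℚ.+ seq y n
cauchy (x + y) δ 0<δ =
  let N , p = cauchy x (½ ℚ.* δ) (half-pos 0<δ)
      M , q = cauchy y (½ ℚ.* δ) (half-pos 0<δ)
  in N ℕ.⊔ M , λ m n Nm Nn → +-close (seq x m) (seq y m) (seq x n) (seq y n)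
       (p m n (ℕₚ.m⊔n≤o⇒m≤o N M Nm) (ℕₚ.m⊔n≤o⇒m≤o N M Nn))
       (q m n (ℕₚ.m⊔n≤o⇒n≤o N M Nm) (ℕₚ.m⊔n≤o⇒n≤o N M Nn))

_⊓_ : ℝ → ℝ → ℝ
seq (x ⊓ y) n = seq x n ℚ.⊓ seq y n
cauchy (x ⊓ y) δ 0<δ =
  let N , p = cauchy x δ 0<δ
      M , q = cauchy y δ 0<δ
  in N ℕ.⊔ M , λ m n Nm Nn → ⊓-close (seq x m) (seq y m) (seq x n) (seq y n)
       (p m n (ℕₚ.m⊔n≤o⇒m≤o N M Nm) (ℕₚ.m⊔n≤o⇒m≤o N M Nn))
       (q m n (ℕₚ.m⊔n≤o⇒n≤o N M Nm) (ℕₚ.m⊔n≤o⇒n≤o N M Nn))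

-- ℝ ∪ {∞}, with nothing as ∞.

ℝ∞ : Set
ℝ∞ = Maybe ℝ

infix 4 _≈∞_

_≈∞_ : ℝ∞ → ℝ∞ → Set
_≈∞_ = Pointwise _≈_

minimum : List ℝ → ℝ∞
minimum []       = nothing
minimum (x ∷ xs) with minimum xs
... | nothing = just x
... | just y  = just (x ⊓ y)

comprehension : ∀ {n} {P : Fin n → Set} → Decidable P → Subset n
comprehension P? = Vec.tabulate (does ∘ P?)

image : ∀ {m n} → (Fin m → Fin n) → Subset m → Subset n
image f A = comprehension (λ y → any? (λ x → (x ∈? A) ×-dec (f x ≟ y)))

allSubsets : ∀ n → List (Subset n)
allSubsets ℕ.zero    = Vec.[] ∷ []
allSubsets (ℕ.suc n) =
  map (inside Vec.∷_) (allSubsets n) ++ map (outside Vec.∷_) (allSubsets n)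

-- Graphs: finite, undirected, loopless, parallel edges allowed.  The
-- order of the two ends of an edge carries no meaning: every notion
-- below sees it only through Joins or treats the ends symmetrically.

record Graph : Set where
  field
    #V #E    : ℕ
    end₁     : Fin #E → Fin #V
    end₂     : Fin #E → Fin #V
    loopless : ∀ e → end₁ e ≢ end₂ e

  V E : Set
  V = Fin #V
  E = Fin #E

  Joins : E → V → V → Set
  Joins e u v = (end₁ e ≡ u × end₂ e ≡ v) ⊎ (end₁ e ≡ v × end₂ e ≡ u)

  IsSubgraph : Subset #V → Subset #E → Set
  IsSubgraph X F = ∀ e → e ∈ F → end₁ e ∈ X × end₂ e ∈ X

  Adjacent : Subset #E → V → V → Set
  Adjacent F u v = ∃ λ e → e ∈ F × Joins e u v

  -- Connectedness of the subgraph (X , F); the null graph is not connected.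
  IsConnected : Subset #V → Subset #E → Set
  IsConnected X F =
    Nonempty X × (∀ u v → u ∈ X → v ∈ X → Star (Adjacent F) u v)

  inducedEdges : Subset #V → Subset #E
  inducedEdges X = comprehension (λ e → (end₁ e ∈? X) ×-dec (end₂ e ∈? X))

  IsConnectedSubgraphOn : Subset #V → Subset #V × Subset #E → Set
  IsConnectedSubgraphOn A (X , F) = IsSubgraph X F × IsConnected X F × A ⊆ X

  private
    AdjIn : List E → V → V → Set
    AdjIn es u v = Any (λ e → Joins e u v) es

    Through : E → List E → V → V → Set
    Through e es u v =
      Star (AdjIn es) u v
      ⊎ (Star (AdjIn es) u (end₁ e) × Star (AdjIn es) (end₂ e) v)
      ⊎ (Star (AdjIn es) u (end₂ e) × Star (AdjIn es) (end₁ e) v)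

    through⇒star : ∀ {e es u v} → Through e es u v → Star (AdjIn (e ∷ es)) u v
    through⇒star (inj₁ p) = Star.map there p
    through⇒star (inj₂ (inj₁ (p , q))) =
      Star.map there p ◅◅ here (inj₁ (refl , refl)) ◅ Star.map there q
    through⇒star (inj₂ (inj₂ (p , q))) =
      Star.map there p ◅◅ here (inj₂ (refl , refl)) ◅ Star.map there q

    star⇒through : ∀ {e es u v} → Star (AdjIn (e ∷ es)) u v → Through e es u v
    star⇒through ε = inj₁ ε
    star⇒through (here (inj₁ (refl , refl)) ◅ p) with star⇒through p
    ... | inj₁ q                = inj₂ (inj₁ (ε , q))
    ... | inj₂ (inj₁ (_ , q))   = inj₂ (inj₁ (ε , q))
    ... | inj₂ (inj₂ (_ , q))   = inj₁ q
    star⇒through (here (inj₂ (refl , refl)) ◅ p) with star⇒through p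
    ... | inj₁ q                = inj₂ (inj₂ (ε , q))
    ... | inj₂ (inj₁ (_ , q))   = inj₁ q
    ... | inj₂ (inj₂ (_ , q))   = inj₂ (inj₂ (ε , q))
    star⇒through (there a ◅ p) with star⇒through p
    ... | inj₁ q                = inj₁ (a ◅ q)
    ... | inj₂ (inj₁ (q , r))   = inj₂ (inj₁ (a ◅ q , r))
    ... | inj₂ (inj₂ (q , r))   = inj₂ (inj₂ (a ◅ q , r))

    starIn? : ∀ es u v → Dec (Star (AdjIn es) u v)
    starIn? [] u v = map′ (λ { refl → ε }) (λ { ε → refl ; (() ◅ _) }) (u ≟ v)
    starIn? (e ∷ es) u v = map′ through⇒star star⇒through
      (starIn? es u v
       ⊎-dec ((starIn? es u (end₁ e) ×-dec starIn? es (end₂ e) v)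
       ⊎-dec (starIn? es u (end₂ e) ×-dec starIn? es (end₁ e) v)))

    adjIn⇒adj : ∀ {F u v} → AdjIn (filter (_∈? F) (allFin #E)) u v → Adjacent F u v
    adjIn⇒adj a with find a
    ... | e , e∈ , j = e , proj₂ (∈-filter⁻ (_∈? _) {xs = allFin #E} e∈) , j

    adj⇒adjIn : ∀ {F u v} → Adjacent F u v → AdjIn (filter (_∈? F) (allFin #E)) u v
    adj⇒adjIn (e , e∈F , j) = lose (∈-filter⁺ (_∈? _) (∈-allFin e) e∈F) j

  star? : ∀ F u v → Dec (Star (Adjacent F) u v)
  star? F u v = map′ (Star.map adjIn⇒adj) (Star.map adj⇒adjIn)
    (starIn? (filter (_∈? F) (allFin #E)) u v)

  isSubgraph? : ∀ X F → Dec (IsSubgraph X F)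
  isSubgraph? X F = all? λ e → (e ∈? F) →-dec ((end₁ e ∈? X) ×-dec (end₂ e ∈? X))

  isConnected? : ∀ X F → Dec (IsConnected X F)
  isConnected? X F = nonempty? X ×-dec
    all? λ u → all? λ v → (u ∈? X) →-dec ((v ∈? X) →-dec star? F u v)

  isConnectedSubgraphOn? : ∀ A → Decidable (IsConnectedSubgraphOn A)
  isConnectedSubgraphOn? A (X , F) =
    isSubgraph? X F ×-dec (isConnected? X F ×-dec (A ⊆? X))

open Graph public using (#V; #E; V; E)

record LengthFunction (G : Graph) : Set where
  field
    length   : E G → ℝ
    positive : ∀ e → 0ℝ < length e

open LengthFunction public

totalLength : ∀ {G} → LengthFunction G → Subset (#E G) → ℝ
totalLength {G} ℓ F = foldr _+_ 0ℝ (map (length ℓ) (filter (_∈? F) (allFin (#E G))))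

sd : (G : Graph) → LengthFunction G → Subset (#V G) → ℝ∞
sd G ℓ A = minimum (map (totalLength ℓ ∘ proj₂)
  (filter (Graph.isConnectedSubgraphOn? G A)
    (cartesianProduct (allSubsets (#V G)) (allSubsets (#E G)))))

-- H ⊆ G, up to renaming the vertices and edges of H

record _↪_ (H G : Graph) : Set where
  field
    vmap           : V H → V G
    emap           : E H → E G
    vmap-injective : Injective _≡_ _≡_ vmap
    emap-injective : Injective _≡_ _≡_ emap
    incidence      : ∀ e →
      Graph.Joins G (emap e) (vmap (Graph.end₁ H e)) (vmap (Graph.end₂ H e))

open _↪_ public

restrict : ∀ {H G} → H ↪ G → LengthFunction G → LengthFunction H
length   (restrict ι ℓ) = length ℓ ∘ emap ι
positive (restrict ι ℓ) = positive ℓ ∘ emap ι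

Geodesic : ℕ → ∀ {H G} → H ↪ G → LengthFunction G → Set
Geodesic k {H} {G} ι ℓ = (A : Subset (#V H)) → ∣ A ∣ ℕ.≤ k →
  sd H (restrict ι ℓ) A ≈∞ sd G ℓ (image (vmap ι) A)

FullyGeodesic : ∀ {H G} → H ↪ G → LengthFunction G → Set
FullyGeodesic ι ℓ = ∀ k → Geodesic k ι ℓ

ℋ : ℕ → Graph → Set
ℋ k H = (G : Graph) (ι : H ↪ G) (ℓ : LengthFunction G) →
  Geodesic k ι ℓ → FullyGeodesic ι ℓ

-- Minors.  The branch sets are contracted to the vertices of G; edge
-- sends distinct (possibly parallel) edges of G to distinct edges of H.

record _IsMinorOf_ (G H : Graph) : Set where
  field
    branch         : V G → Subset (#V H)
    disjoint       : ∀ {x y v} → v ∈ branch x → v ∈ branch y → x ≡ y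
    connected      : ∀ x →
      Graph.IsConnected H (branch x) (Graph.inducedEdges H (branch x))
    edge           : E G → E H
    edge-injective : Injective _≡_ _≡_ edge
    edge-joins     : ∀ e → ∃ λ u → ∃ λ v →
      u ∈ branch (Graph.end₁ G e) × v ∈ branch (Graph.end₂ G e) × Graph.Joins H (edge e) u v

{-# OPTIONS --safe #-}
-- Let G be a minor of H ∈ ℋ k, and let G be k-geodesic in G′; extend H to some H′ ⊇ H
-- in which H is k-geodesic, hence fully geodesic, and read the result off in G′.
--
-- Deleting an edge e = xy: H′ is G′ plus e, with e longer than all of G′.  A connected
-- subgraph through the bridge e splits into two parts with terminal sets A₁ ∪ {x} and
-- A₂ ∪ {y}; if A₁ and A₂ are nonempty, these have at most |A| ≤ k elements each.
--
-- Once every edge of H is an edge of G or lies in a branch set: H′ is H with G′ glued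
-- to it along roots of the branch sets.  Contracted edges get length η, and every
-- edge coming from G′ is lengthened by some P ≥ (number of edges of H) · η.  A
-- subgraph using an edge from G′ pays P, which suffices to lift a subgraph of G to
-- H, so H is k-geodesic in H′.  Letting P → 0 gives the claim.

module Submission where

open import Data.Empty using (⊥-elim)
open import Data.Fin using (Fin; zero; suc; _≟_; punchIn; punchOut; splitAt; _↑ˡ_; _↑ʳ_)
open import Data.Fin.Properties using (any?; suc-injective; ↑ˡ-injective; ↑ʳ-injective; splitAt-↑ˡ; splitAt-↑ʳ; join-splitAt; punchIn-injective; punchInᵢ≢i; punchIn-punchOut; punchOut-injective; 0≢1+n)
open import Data.Fin.Subset using (Subset; inside; outside; _∈_; _⊆_; _∪_; _-_; ⁅_⁆; ⊤; ⊥; Nonempty; Empty; ∣_∣)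
open import Data.Fin.Subset.Properties using (_∈?_; nonempty?; ∉⊥; ∈⊤; x∈⁅x⁆; x∈⁅y⁆⇒x≡y; x∈p∪q⁺; x∈p∪q⁻; q⊆p∪q; x∈p∧x≢y⇒x∈p-y; p⊆q⇒∣p∣≤∣q∣; p⊂q⇒∣p∣<∣q∣; ∣⊥∣≡0; ∣⁅x⁆∣≡1; p─⊥≡p; Empty-unique)
open import Data.List using (List; []; _∷_; map; foldr; filter; tabulate; cartesianProduct)
import Data.List.Membership.Propositional as List
open import Data.List.Membership.Propositional.Properties using (∈-filter⁺; ∈-filter⁻; ∈-map⁺; ∈-map⁻; ∈-++⁺ˡ; ∈-++⁺ʳ; ∈-cartesianProduct⁺)
open import Data.List.Relation.Unary.Any using (here; there)
open import Data.Maybe using (just; nothing)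
open import Data.Maybe.Relation.Binary.Pointwise using (just; nothing)
open import Data.Nat using (ℕ; _≤_)
import Data.Nat as ℕ
import Data.Nat.Properties as ℕₚ
open import Data.Product using (∃; ∃₂; _×_; _,_; proj₁; proj₂)
open import Data.Rational using (ℚ; 0ℚ; 1ℚ; ½)
import Data.Rational as ℚ
import Data.Rational.Properties as ℚₚ
open import Data.Rational.Solver using (module +-*-Solver)
open import Data.Sum using (_⊎_; inj₁; inj₂; [_,_]′; swap)
import Data.Vec as Vec
open import Data.Vec.Properties using (lookup∘tabulate; []=⇒lookup; lookup⇒[]=)
open import Data.Vec.Base using ([]; _∷_; here; there)
open import Function using (_∘_; id)
open import Relation.Binary.Construct.Closure.ReflexiveTransitive as Star using (Star; ε; _◅_; _◅◅_)
open import Relation.Binary.PropositionalEquality using (_≡_; _≢_; refl; sym; trans; cong; cong₂; subst; subst₂)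
open import Relation.Nullary using (Dec; yes; no; ¬_; does)
open import Relation.Nullary.Decidable using (_×-dec_; _⊎-dec_; ¬?; dec-true; decidable-stable; from-yes)
open import Relation.Unary using (Decidable)
open import Defs

open +-*-Solver using (solve; _:=_; _:+_; _:-_; :-_)
open Graph using (end₁; end₂; loopless; Joins; IsSubgraph; Adjacent; IsConnected; inducedEdges; star?)

-- Deletion has to come first: a connected subgraph of `H` may use an edge that is neither an edge
-- of `G` nor inside a branch set, and its collapse need then not be connected in `G`. The great
-- length of e has one purpose: the subgraph of `H` that full geodesicity provides cannot afford e,
-- and so it lies in the graph without e. If A₁ or A₂ is empty, the set A ∪ {x} or A ∪ {y} may have
-- k + 1 elements, beyond the reach of the hypothesis; but then the component that holds all of A
-- suffices, and e is dropped. In the contraction step, zero is not an admissible length, so lifting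
-- a subgraph of `G` to `H` costs something for the inner edges of the branch sets; P is the
-- allowance for this. Minimal subgraphs cannot be selected constructively, so every comparison of
-- lengths carries an arbitrary slack δ > 0. The limit P → 0 then takes the form of a choice: given
-- δ, P is so small that all the excess it causes is at most δ/2.

-- Properties holding from some index on, and estimates for rationals

Eventually : (ℕ → Set) → Set
Eventually P = ∃ λ N → ∀ n → N ≤ n → P n

always : ∀ {P : ℕ → Set} → (∀ n → P n) → Eventually P
always p = 0 , λ n _ → p n

eventually-map : ∀ {P Q : ℕ → Set} → (∀ n → P n → Q n) → Eventually P → Eventually Q
eventually-map f (N , p) = N , λ n N≤n → f n (p n N≤n)

eventually-zip : ∀ {P Q R : ℕ → Set} →
  (∀ n → P n → Q n → R n) → Eventually P → Eventually Q → Eventually R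
eventually-zip f (N , p) (M , q) = N ℕ.⊔ M , λ n h →
  f n (p n (ℕₚ.m⊔n≤o⇒m≤o N M h)) (q n (ℕₚ.m⊔n≤o⇒n≤o N M h))

eventually-all : ∀ {m} {P : Fin m → ℕ → Set} →
  (∀ i → Eventually (P i)) → Eventually (λ n → ∀ i → P i n)
eventually-all {ℕ.zero}  _ = always λ _ ()
eventually-all {ℕ.suc m} p = eventually-zip
  (λ { n p₀ ps zero → p₀ ; n p₀ ps (suc i) → ps i })
  (p zero) (eventually-all (p ∘ suc))

half-positive : ∀ {δ} → 0ℚ ℚ.< δ → 0ℚ ℚ.< ½ ℚ.* δ
half-positive {δ} 0<δ =
  subst (ℚ._< ½ ℚ.* δ) (ℚₚ.*-zeroʳ ½) (ℚₚ.*-monoʳ-<-pos ½ 0<δ)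

half+half : ∀ δ → ½ ℚ.* δ ℚ.+ ½ ℚ.* δ ≡ δ
half+half δ = trans (sym (ℚₚ.*-distribʳ-+ δ ½ ½)) (ℚₚ.*-identityˡ δ)

+half+half : ∀ a δ → a ℚ.+ ½ ℚ.* δ ℚ.+ ½ ℚ.* δ ≡ a ℚ.+ δ
+half+half a δ = trans (ℚₚ.+-assoc a _ _) (cong (a ℚ.+_) (half+half δ))

x≤x+y : ∀ x {y} → 0ℚ ℚ.≤ y → x ℚ.≤ x ℚ.+ y
x≤x+y x 0≤y = ℚₚ.≤-trans (ℚₚ.≤-reflexive (sym (ℚₚ.+-identityʳ x))) (ℚₚ.+-monoʳ-≤ x 0≤y)

y≤x+y : ∀ {x} y → 0ℚ ℚ.≤ x → y ℚ.≤ x ℚ.+ y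
y≤x+y y 0≤x = ℚₚ.≤-trans (ℚₚ.≤-reflexive (sym (ℚₚ.+-identityˡ y))) (ℚₚ.+-monoˡ-≤ y 0≤x)

close⇒≤ˡ : ∀ {p q δ} → ℚ.∣ p ℚ.- q ∣ ℚ.< δ → p ℚ.≤ q ℚ.+ δ
close⇒≤ˡ {p} {q} {δ} h = ℚₚ.≤-trans
  (ℚₚ.≤-reflexive (solve 2 (λ p q → p := q :+ (p :- q)) refl p q))
  (ℚₚ.+-monoʳ-≤ q (ℚₚ.≤-trans p-q≤ (ℚₚ.<⇒≤ h)))
  where
  p-q≤ : p ℚ.- q ℚ.≤ ℚ.∣ p ℚ.- q ∣
  p-q≤ with ℚₚ.≤-total 0ℚ (p ℚ.- q)
  ... | inj₁ 0≤ = ℚₚ.≤-reflexive (sym (ℚₚ.0≤p⇒∣p∣≡p 0≤))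
  ... | inj₂ ≤0 = ℚₚ.≤-trans ≤0 (ℚₚ.0≤∣p∣ _)

close⇒≤ʳ : ∀ {p q δ} → ℚ.∣ p ℚ.- q ∣ ℚ.< δ → q ℚ.≤ p ℚ.+ δ
close⇒≤ʳ {p} {q} {δ} h = close⇒≤ˡ (subst (ℚ._< δ)
  (trans (sym (ℚₚ.∣-p∣≡∣p∣ (p ℚ.- q)))
    (cong ℚ.∣_∣ (solve 2 (λ p q → :- (p :- q) := q :- p) refl p q))) h)

≤⇒close : ∀ {p q δ} → 0ℚ ℚ.< δ → p ℚ.≤ q ℚ.+ ½ ℚ.* δ → q ℚ.≤ p ℚ.+ ½ ℚ.* δ → ℚ.∣ p ℚ.- q ∣ ℚ.< δ
≤⇒close {p} {q} {δ} 0<δ h₁ h₂ = ℚₚ.≤-<-trans ∣p-q∣≤ ½δ<δ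
  where
  ½δ<δ : ½ ℚ.* δ ℚ.< δ
  ½δ<δ = subst₂ ℚ._<_ (ℚₚ.+-identityʳ _) (half+half δ) (ℚₚ.+-monoʳ-< (½ ℚ.* δ) (half-positive 0<δ))
  diff≤ : ∀ x y → x ℚ.≤ y ℚ.+ ½ ℚ.* δ → x ℚ.- y ℚ.≤ ½ ℚ.* δ
  diff≤ x y h = ℚₚ.≤-trans (ℚₚ.+-monoˡ-≤ (ℚ.- y) h)
    (ℚₚ.≤-reflexive (solve 2 (λ y z → y :+ z :- y := z) refl y (½ ℚ.* δ)))
  ∣p-q∣≤ : ℚ.∣ p ℚ.- q ∣ ℚ.≤ ½ ℚ.* δ
  ∣p-q∣≤ with ℚₚ.∣p∣≡p∨∣p∣≡-p (p ℚ.- q)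
  ... | inj₁ eq = subst (ℚ._≤ ½ ℚ.* δ) (sym eq) (diff≤ p q h₁)
  ... | inj₂ eq = subst (ℚ._≤ ½ ℚ.* δ)
    (sym (trans eq (solve 2 (λ p q → :- (p :- q) := q :- p) refl p q))) (diff≤ q p h₂)

-- Comparison of reals up to a slack, and minima of lists

infix 4 _≲[_]_

_≲[_]_ : ℝ → ℚ → ℝ → Set
x ≲[ δ ] y = Eventually λ n → seq x n ℚ.≤ seq y n ℚ.+ δ

≲-refl : ∀ {x δ} → 0ℚ ℚ.< δ → x ≲[ δ ] x
≲-refl 0<δ = always λ n → x≤x+y _ (ℚₚ.<⇒≤ 0<δ)

≲-trans : ∀ {x y z δ} → x ≲[ ½ ℚ.* δ ] y → y ≲[ ½ ℚ.* δ ] z → x ≲[ δ ] z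
≲-trans {x} {y} {z} {δ} = eventually-zip λ n p q → ℚₚ.≤-trans p
  (ℚₚ.≤-trans (ℚₚ.+-monoˡ-≤ (½ ℚ.* δ) q) (ℚₚ.≤-reflexive (+half+half (seq z n) δ)))

-- One rational comparison decides: beyond a common index `K` each sequence stays within δ/2 of its
-- `K`-th term, so comparing these two terms settles the tails up to δ.
≲-total : ∀ x y {δ} → 0ℚ ℚ.< δ → x ≲[ δ ] y ⊎ y ≲[ δ ] x
≲-total x y {δ} 0<δ
  with cauchy x (½ ℚ.* δ) (half-positive 0<δ) | cauchy y (½ ℚ.* δ) (half-positive 0<δ)
... | N , p | M , q = go (ℚₚ.≤-total (seq x K) (seq y K))
  where
  K = N ℕ.⊔ M
  N≤ : ∀ {n} → K ≤ n → N ≤ n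
  N≤ = ℕₚ.m⊔n≤o⇒m≤o N M
  M≤ : ∀ {n} → K ≤ n → M ≤ n
  M≤ = ℕₚ.m⊔n≤o⇒n≤o N M
  chain : ∀ {a b c d} → a ℚ.≤ b ℚ.+ ½ ℚ.* δ → b ℚ.≤ c → c ℚ.≤ d ℚ.+ ½ ℚ.* δ → a ℚ.≤ d ℚ.+ δ
  chain {d = d} h₁ h₂ h₃ = ℚₚ.≤-trans h₁ (ℚₚ.≤-trans
    (ℚₚ.+-monoˡ-≤ _ (ℚₚ.≤-trans h₂ h₃)) (ℚₚ.≤-reflexive (+half+half d δ)))
  go : seq x K ℚ.≤ seq y K ⊎ seq y K ℚ.≤ seq x K → x ≲[ δ ] y ⊎ y ≲[ δ ] x
  go (inj₁ h) = inj₁ (K , λ n K≤n → chain {d = seq y n}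
    (close⇒≤ˡ (p n K (N≤ K≤n) (N≤ ℕₚ.≤-refl))) h (close⇒≤ʳ {seq y n} (q n K (M≤ K≤n) (M≤ ℕₚ.≤-refl))))
  go (inj₂ h) = inj₂ (K , λ n K≤n → chain {d = seq x n}
    (close⇒≤ˡ (q n K (M≤ K≤n) (M≤ ℕₚ.≤-refl))) h (close⇒≤ʳ {seq x n} (p n K (N≤ K≤n) (N≤ ℕₚ.≤-refl))))

⊓-≲-greatest : ∀ {x y z δ} → x ≲[ δ ] y → x ≲[ δ ] z → x ≲[ δ ] y ⊓ z
⊓-≲-greatest {x} {y} {z} {δ} = eventually-zip λ n p q →
  [ (λ eq → subst (λ t → seq x n ℚ.≤ t ℚ.+ δ) (sym eq) p)
  , (λ eq → subst (λ t → seq x n ℚ.≤ t ℚ.+ δ) (sym eq) q) ]′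
  (ℚₚ.⊓-sel (seq y n) (seq z n))

minimum-lower : ∀ {x xs} → x List.∈ xs →
  ∃ λ m → minimum xs ≡ just m × (∀ n → seq m n ℚ.≤ seq x n)
minimum-lower {xs = y ∷ xs} x∈ with minimum xs in eq
minimum-lower (here refl) | nothing = _ , refl , λ n → ℚₚ.≤-refl
minimum-lower (there x∈)  | nothing with minimum-lower x∈
... | _ , eq′ , _ with trans (sym eq) eq′
... | ()
minimum-lower (here refl) | just m = _ , refl , λ n → ℚₚ.p⊓q≤p _ _
minimum-lower {xs = y ∷ xs} (there x∈)  | just m with minimum-lower x∈
... | m′ , eq′ , m′≤x with trans (sym eq) eq′
... | refl = _ , refl , λ n → ℚₚ.≤-trans (ℚₚ.p⊓q≤q (seq y n) _) (m′≤x n)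

-- At each entry the slack is halved: one half for the value found in the tail, the other for
-- deciding with `≲-total` which argument of `x ⊓ y` to keep.
minimum-attained : ∀ xs {m δ} → minimum xs ≡ just m → 0ℚ ℚ.< δ →
  ∃ λ x → x List.∈ xs × x ≲[ δ ] m
minimum-attained (x ∷ xs) eq 0<δ with minimum xs in eqₓₛ
minimum-attained (x ∷ xs) refl 0<δ | nothing = x , here refl , ≲-refl {x} 0<δ
minimum-attained (x ∷ xs) {δ = δ} refl 0<δ | just y
  with minimum-attained xs eqₓₛ (half-positive 0<δ) | ≲-total x y (half-positive 0<δ)
... | z , z∈ , z≲y | inj₁ x≲y = x , here refl , ⊓-≲-greatest {x} {x} {y}
  (≲-refl {x} 0<δ) (≲-trans {x} {y} {y} x≲y (≲-refl {y} (half-positive 0<δ)))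
... | z , z∈ , z≲y | inj₂ y≲x = z , there z∈ , ⊓-≲-greatest {z} {x} {y}
  (≲-trans {z} {y} {x} z≲y y≲x) (≲-trans {z} {y} {y} z≲y (≲-refl {y} (half-positive 0<δ)))

-- Minima cannot be compared by picking minimisers, as the order of ℝ is
-- undecidable; approximate minimisers always exist.
Dominated : List ℝ → List ℝ → Set
Dominated xs ys = ∀ {y} → y List.∈ ys → ∀ δ → 0ℚ ℚ.< δ → ∃ λ x → x List.∈ xs × x ≲[ δ ] y

minimum-≲ : ∀ {xs ys m m′} → Dominated xs ys → minimum xs ≡ just m → minimum ys ≡ just m′ →
  ∀ {δ} → 0ℚ ℚ.< δ → m ≲[ δ ] m′
minimum-≲ {xs} {ys} {m} {m′} dom eq eq′ {δ} 0<δ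
  with minimum-attained ys eq′ (half-positive 0<δ)
... | y , y∈ , y≲m′ with dom y∈ (½ ℚ.* δ) (half-positive 0<δ)
... | x , x∈ , x≲y with minimum-lower x∈
... | m″ , eq″ , m≤x with trans (sym eq) eq″
... | refl = ≲-trans {m} {y} {m′} (eventually-map (λ n → ℚₚ.≤-trans (m≤x n)) x≲y) y≲m′

minimum-finite : ∀ {xs ys m} → Dominated xs ys → minimum ys ≡ just m → minimum xs ≢ nothing
minimum-finite {xs} {ys} dom eq eq′ with minimum-attained ys eq (half-positive (ℚₚ.positive⁻¹ 1ℚ))
... | y , y∈ , _ with dom y∈ 1ℚ (ℚₚ.positive⁻¹ 1ℚ)
... | x , x∈ , _ with minimum-lower x∈
... | _ , eq″ , _ with trans (sym eq′) eq″
... | ()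

minimum-≈ : ∀ {xs ys} → Dominated xs ys → Dominated ys xs → minimum xs ≈∞ minimum ys
minimum-≈ {xs} {ys} d₁ d₂ with minimum xs in eq | minimum ys in eq′
... | nothing | nothing = nothing
... | nothing | just _  = ⊥-elim (minimum-finite d₁ eq′ eq)
... | just _  | nothing = ⊥-elim (minimum-finite d₂ eq eq′)
... | just m  | just m′ = just λ δ 0<δ → eventually-zip
  (λ n → ≤⇒close {seq m n} {seq m′ n} 0<δ)
  (minimum-≲ {xs} {ys} {m} {m′} d₁ eq eq′ (half-positive 0<δ))
  (minimum-≲ {ys} {xs} {m′} {m} d₂ eq′ eq (half-positive 0<δ))

minimum-≈⇒dominated : ∀ {xs ys} → minimum xs ≈∞ minimum ys → Dominated xs ys
minimum-≈⇒dominated {xs} {ys} h {y} y∈ δ 0<δ with minimum-lower y∈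
... | m′ , eq′ , m′≤y with minimum xs in eq | minimum ys
minimum-≈⇒dominated {xs} {ys} (just m≈m′) {y} y∈ δ 0<δ | m′ , refl , m′≤y | just m | just .m′
  with minimum-attained xs eq (half-positive 0<δ)
... | x , x∈ , x≲m = x , x∈ , ≲-trans {x} {m} {y} x≲m (eventually-map
  (λ n c → ℚₚ.≤-trans (close⇒≤ˡ {seq m n} {seq m′ n} c) (ℚₚ.+-monoˡ-≤ _ (m′≤y n)))
  (m≈m′ (½ ℚ.* δ) (half-positive 0<δ)))

-- Sums over subsets

sumOver : ∀ {n} → (Fin n → ℚ) → Subset n → ℚ
sumOver w []            = 0ℚ
sumOver w (inside  ∷ F) = w zero ℚ.+ sumOver (w ∘ suc) F
sumOver w (outside ∷ F) = sumOver (w ∘ suc) F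

sumOver-nonneg : ∀ {n} {w : Fin n → ℚ} → (∀ i → 0ℚ ℚ.≤ w i) → ∀ F → 0ℚ ℚ.≤ sumOver w F
sumOver-nonneg w≥0 []            = ℚₚ.≤-refl
sumOver-nonneg w≥0 (inside  ∷ F) = ℚₚ.+-mono-≤ (w≥0 zero) (sumOver-nonneg (w≥0 ∘ suc) F)
sumOver-nonneg w≥0 (outside ∷ F) = sumOver-nonneg (w≥0 ∘ suc) F

sumOver-remove : ∀ {n} (w : Fin n → ℚ) {i F} → i ∈ F → sumOver w F ≡ w i ℚ.+ sumOver w (F - i)
sumOver-remove w {F = inside ∷ F} here =
  cong (λ K → w zero ℚ.+ sumOver (w ∘ suc) K) (sym (p─⊥≡p F))
sumOver-remove w {suc i} {inside ∷ F} (there i∈F) = trans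
  (cong (w zero ℚ.+_) (sumOver-remove (w ∘ suc) i∈F))
  (solve 3 (λ a b c → a :+ (b :+ c) := b :+ (a :+ c)) refl (w zero) (w (suc i)) _)
sumOver-remove w {F = outside ∷ F} (there i∈F) = sumOver-remove (w ∘ suc) i∈F

sumOver-member : ∀ {n} {w : Fin n → ℚ} → (∀ i → 0ℚ ℚ.≤ w i) → ∀ {i F} → i ∈ F → w i ℚ.≤ sumOver w F
sumOver-member {w = w} w≥0 {i} {F} i∈F = ℚₚ.≤-trans
  (x≤x+y (w i) (sumOver-nonneg w≥0 (F - i))) (ℚₚ.≤-reflexive (sym (sumOver-remove w i∈F)))

-- The injection is a relation, so that partners are needed only on `K` and may be found by case
-- distinction. Each element of `K` uses up its partner, which is removed from `F`; by `R-inj` the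
-- partners of the remaining elements are still there.
sumOver-injection : ∀ {m n} {a : Fin m → ℚ} {b : Fin n → ℚ} → (∀ j → 0ℚ ℚ.≤ b j) →
  (R : Fin m → Fin n → Set) → (∀ {i i′ j} → R i j → R i′ j → i ≡ i′) →
  ∀ K F → (∀ i → i ∈ K → ∃ λ j → j ∈ F × R i j × a i ℚ.≤ b j) → sumOver a K ℚ.≤ sumOver b F
sumOver-injection b≥0 R R-inj []            F φ = sumOver-nonneg b≥0 F
sumOver-injection b≥0 R R-inj (outside ∷ K) F φ =
  sumOver-injection b≥0 (R ∘ suc) (λ r r′ → suc-injective (R-inj r r′)) K F (λ i → φ (suc i) ∘ there)
sumOver-injection {a = a} {b} b≥0 R R-inj (inside ∷ K) F φ with φ zero here
... | j , j∈F , r , a≤b = ℚₚ.≤-trans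
  (ℚₚ.+-mono-≤ a≤b (sumOver-injection b≥0 (R ∘ suc) (λ r r′ → suc-injective (R-inj r r′)) K (F - j) ψ))
  (ℚₚ.≤-reflexive (sym (sumOver-remove b j∈F)))
  where
  ψ : ∀ i → i ∈ K → ∃ λ j′ → j′ ∈ F - j × R (suc i) j′ × a (suc i) ℚ.≤ b j′
  ψ i i∈K with φ (suc i) (there i∈K)
  ... | j′ , j′∈F , r′ , a≤b′ =
    j′ , x∈p∧x≢y⇒x∈p-y j′∈F (λ { refl → 0≢1+n (R-inj r r′) }) , r′ , a≤b′

sumOver-mono : ∀ {n} {a b : Fin n → ℚ} → (∀ j → 0ℚ ℚ.≤ b j) →
  ∀ {K F} → K ⊆ F → (∀ i → i ∈ K → a i ℚ.≤ b i) → sumOver a K ℚ.≤ sumOver b F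
sumOver-mono b≥0 {K} {F} K⊆F a≤b = sumOver-injection b≥0 _≡_ (λ { refl refl → refl }) K F
  (λ i i∈K → i , K⊆F i∈K , refl , a≤b i i∈K)

sumOver-∪ : ∀ {n} {w : Fin n → ℚ} → (∀ i → 0ℚ ℚ.≤ w i) →
  ∀ K F → sumOver w (K ∪ F) ℚ.≤ sumOver w K ℚ.+ sumOver w F
sumOver-∪ w≥0 [] [] = ℚₚ.≤-refl
sumOver-∪ w≥0 (outside ∷ K) (outside ∷ F) = sumOver-∪ (w≥0 ∘ suc) K F
sumOver-∪ {w = w} w≥0 (inside ∷ K) (outside ∷ F) = ℚₚ.≤-trans
  (ℚₚ.+-monoʳ-≤ (w zero) (sumOver-∪ (w≥0 ∘ suc) K F))
  (ℚₚ.≤-reflexive (sym (ℚₚ.+-assoc (w zero) _ _)))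
sumOver-∪ {w = w} w≥0 (outside ∷ K) (inside ∷ F) = ℚₚ.≤-trans
  (ℚₚ.+-monoʳ-≤ (w zero) (sumOver-∪ (w≥0 ∘ suc) K F))
  (ℚₚ.≤-reflexive (solve 3 (λ a b c → a :+ (b :+ c) := b :+ (a :+ c)) refl
    (w zero) (sumOver (w ∘ suc) K) (sumOver (w ∘ suc) F)))
sumOver-∪ {w = w} w≥0 (inside ∷ K) (inside ∷ F) = ℚₚ.≤-trans
  (ℚₚ.+-monoʳ-≤ (w zero) (sumOver-∪ (w≥0 ∘ suc) K F))
  (ℚₚ.≤-trans (ℚₚ.≤-reflexive (sym (ℚₚ.+-assoc (w zero) (sumOver (w ∘ suc) K) (sumOver (w ∘ suc) F))))
    (ℚₚ.+-monoʳ-≤ (w zero ℚ.+ sumOver (w ∘ suc) K) (y≤x+y (sumOver (w ∘ suc) F) (w≥0 zero))))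

sumOver-disjoint-∪ : ∀ {n} (w : Fin n → ℚ) K F → (∀ {i} → i ∈ K → ¬ i ∈ F) →
  sumOver w K ℚ.+ sumOver w F ≡ sumOver w (K ∪ F)
sumOver-disjoint-∪ w [] [] dis = refl
sumOver-disjoint-∪ w (outside ∷ K) (outside ∷ F) dis =
  sumOver-disjoint-∪ (w ∘ suc) K F (λ p q → dis (there p) (there q))
sumOver-disjoint-∪ w (inside ∷ K) (outside ∷ F) dis = trans (ℚₚ.+-assoc (w zero) _ _)
  (cong (w zero ℚ.+_) (sumOver-disjoint-∪ (w ∘ suc) K F (λ p q → dis (there p) (there q))))
sumOver-disjoint-∪ w (outside ∷ K) (inside ∷ F) dis = trans
  (solve 3 (λ a b c → b :+ (a :+ c) := a :+ (b :+ c)) refl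
    (w zero) (sumOver (w ∘ suc) K) (sumOver (w ∘ suc) F))
  (cong (w zero ℚ.+_) (sumOver-disjoint-∪ (w ∘ suc) K F (λ p q → dis (there p) (there q))))
sumOver-disjoint-∪ w (inside ∷ K) (inside ∷ F) dis = ⊥-elim (dis here here)

sumOver-+ : ∀ {n} (a b : Fin n → ℚ) F →
  sumOver (λ i → a i ℚ.+ b i) F ≡ sumOver a F ℚ.+ sumOver b F
sumOver-+ a b []            = refl
sumOver-+ a b (outside ∷ F) = sumOver-+ (a ∘ suc) (b ∘ suc) F
sumOver-+ a b (inside ∷ F)  = trans
  (cong (a zero ℚ.+ b zero ℚ.+_) (sumOver-+ (a ∘ suc) (b ∘ suc) F))
  (solve 4 (λ a b c d → a :+ b :+ (c :+ d) := (a :+ c) :+ (b :+ d)) refl (a zero) (b zero) _ _)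

sumOver-⊥ : ∀ {n} (w : Fin n → ℚ) → sumOver w ⊥ ≡ 0ℚ
sumOver-⊥ {ℕ.zero}  w = refl
sumOver-⊥ {ℕ.suc n} w = sumOver-⊥ (w ∘ suc)

sumOver-⁅⁆ : ∀ {n} (w : Fin n → ℚ) i → sumOver w ⁅ i ⁆ ≡ w i
sumOver-⁅⁆ w zero    = trans (cong (w zero ℚ.+_) (sumOver-⊥ (w ∘ suc))) (ℚₚ.+-identityʳ (w zero))
sumOver-⁅⁆ w (suc i) = sumOver-⁅⁆ (w ∘ suc) i

⊓-positive : ∀ {p q} → 0ℚ ℚ.< p → 0ℚ ℚ.< q → 0ℚ ℚ.< p ℚ.⊓ q
⊓-positive {p} {q} 0<p 0<q with ℚₚ.⊓-sel p q
... | inj₁ eq = subst (0ℚ ℚ.<_) (sym eq) 0<p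
... | inj₂ eq = subst (0ℚ ℚ.<_) (sym eq) 0<q

-- Halving replaces division by `n`: one half of δ bounds the new summand, the other half bounds the
-- rest. Both η and P are found in this way.
small-weight : ∀ n {δ} → 0ℚ ℚ.< δ → ∃ λ η → 0ℚ ℚ.< η × sumOver {n} (λ _ → η) ⊤ ℚ.≤ δ
small-weight ℕ.zero {δ} 0<δ = δ , 0<δ , ℚₚ.<⇒≤ 0<δ
small-weight (ℕ.suc n) {δ} 0<δ with small-weight n (half-positive 0<δ)
... | η , 0<η , Ση≤ = η ℚ.⊓ (½ ℚ.* δ) , ⊓-positive 0<η (half-positive 0<δ) , ℚₚ.≤-trans
  (ℚₚ.+-mono-≤ (ℚₚ.p⊓q≤q η _) (ℚₚ.≤-trans
    (sumOver-mono (λ _ → ℚₚ.<⇒≤ 0<η) {⊤ {n}} id (λ _ _ → ℚₚ.p⊓q≤p η _)) Ση≤))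
  (ℚₚ.≤-reflexive (half+half δ))

-- Images and preimages of finite sets, and lengths as rational sums

∈-comprehension⁺ : ∀ {n} {P : Fin n → Set} (P? : Decidable P) {i} → P i → i ∈ comprehension P?
∈-comprehension⁺ P? {i} p =
  lookup⇒[]= i _ (trans (lookup∘tabulate (does ∘ P?) i) (dec-true (P? i) p))

∈-comprehension⁻ : ∀ {n} {P : Fin n → Set} (P? : Decidable P) {i} → i ∈ comprehension P? → P i
∈-comprehension⁻ P? {i} i∈
  with P? i | trans (sym (lookup∘tabulate (does ∘ P?) i)) ([]=⇒lookup i∈)
... | yes p | _ = p

∈-image⁺ : ∀ {m n} (f : Fin m → Fin n) {A i} → i ∈ A → f i ∈ image f A
∈-image⁺ f {A} i∈A = ∈-comprehension⁺ (λ y → any? (λ x → (x ∈? A) ×-dec (f x ≟ y))) (_ , i∈A , refl)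

∈-image⁻ : ∀ {m n} (f : Fin m → Fin n) A {j} → j ∈ image f A → ∃ λ i → i ∈ A × f i ≡ j
∈-image⁻ f A = ∈-comprehension⁻ (λ y → any? (λ x → (x ∈? A) ×-dec (f x ≟ y)))

preimage : ∀ {m n} → (Fin m → Fin n) → Subset n → Subset m
preimage f B = comprehension (λ i → f i ∈? B)

∈-preimage⁺ : ∀ {m n} (f : Fin m → Fin n) {B i} → f i ∈ B → i ∈ preimage f B
∈-preimage⁺ f {B} = ∈-comprehension⁺ (λ i → f i ∈? B)

∈-preimage⁻ : ∀ {m n} (f : Fin m → Fin n) B {i} → i ∈ preimage f B → f i ∈ B
∈-preimage⁻ f B = ∈-comprehension⁻ (λ i → f i ∈? B)

sumOver-image : ∀ {m n} {w : Fin n → ℚ} {a : Fin m → ℚ} → (∀ i → 0ℚ ℚ.≤ a i) →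
  (f : Fin m → Fin n) → (∀ i → w (f i) ≡ a i) → ∀ F → sumOver w (image f F) ℚ.≤ sumOver a F
sumOver-image {w = w} a≥0 f w∘f≡a F = sumOver-injection a≥0 (λ j i → f i ≡ j)
  (λ { refl refl → refl }) (image f F) F λ j j∈ →
  let i , i∈F , fi≡j = ∈-image⁻ f F j∈ in
  i , i∈F , fi≡j , ℚₚ.≤-reflexive (trans (cong w (sym fi≡j)) (w∘f≡a i))

sumOver-preimage : ∀ {m n} {w : Fin n → ℚ} {a : Fin m → ℚ} → (∀ j → 0ℚ ℚ.≤ w j) →
  (f : Fin m → Fin n) → (∀ {i i′} → f i ≡ f i′ → i ≡ i′) → (∀ i → a i ≡ w (f i)) →
  ∀ F → sumOver a (preimage f F) ℚ.≤ sumOver w F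
sumOver-preimage w≥0 f f-inj a≡w∘f F = sumOver-injection w≥0 (λ i j → f i ≡ j)
  (λ p q → f-inj (trans p (sym q))) (preimage f F) F λ i i∈ →
  f i , ∈-preimage⁻ f F i∈ , refl , ℚₚ.≤-reflexive (a≡w∘f i)

∣p∪q∣≤∣p∣+∣q∣ : ∀ {n} (p q : Subset n) → ∣ p ∪ q ∣ ≤ ∣ p ∣ ℕ.+ ∣ q ∣
∣p∪q∣≤∣p∣+∣q∣ [] [] = ℕ.z≤n
∣p∪q∣≤∣p∣+∣q∣ (outside ∷ p) (outside ∷ q) = ∣p∪q∣≤∣p∣+∣q∣ p q
∣p∪q∣≤∣p∣+∣q∣ (inside ∷ p) (outside ∷ q) = ℕ.s≤s (∣p∪q∣≤∣p∣+∣q∣ p q)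
∣p∪q∣≤∣p∣+∣q∣ (outside ∷ p) (inside ∷ q) =
  ℕₚ.≤-trans (ℕ.s≤s (∣p∪q∣≤∣p∣+∣q∣ p q)) (ℕₚ.≤-reflexive (sym (ℕₚ.+-suc ∣ p ∣ ∣ q ∣)))
∣p∪q∣≤∣p∣+∣q∣ (inside ∷ p) (inside ∷ q) = ℕ.s≤s (ℕₚ.≤-trans (∣p∪q∣≤∣p∣+∣q∣ p q)
  (ℕₚ.+-monoʳ-≤ ∣ p ∣ (ℕₚ.n≤1+n ∣ q ∣)))

∣⁅x⁆∪p∣≤1+∣p∣ : ∀ {n} x (p : Subset n) → ∣ ⁅ x ⁆ ∪ p ∣ ≤ ℕ.suc ∣ p ∣
∣⁅x⁆∪p∣≤1+∣p∣ x p = subst (λ s → ∣ ⁅ x ⁆ ∪ p ∣ ≤ s ℕ.+ ∣ p ∣) (∣⁅x⁆∣≡1 x) (∣p∪q∣≤∣p∣+∣q∣ ⁅ x ⁆ p)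

∣image∣≤ : ∀ {m n} (f : Fin m → Fin n) A → ∣ image f A ∣ ≤ ∣ A ∣
∣image∣≤ {n = n} f [] = ℕₚ.≤-trans
  (p⊆q⇒∣p∣≤∣q∣ {q = ⊥} (λ x∈ → ⊥-elim (case (∈-image⁻ f [] x∈)))) (ℕₚ.≤-reflexive (∣⊥∣≡0 n))
  where
  case : ∀ {j} → ¬ (∃ λ i → i ∈ [] × f i ≡ j)
  case (() , _)
∣image∣≤ f (outside ∷ A) = ℕₚ.≤-trans (p⊆q⇒∣p∣≤∣q∣ ⊆-tail) (∣image∣≤ (f ∘ suc) A)
  where
  ⊆-tail : image f (outside ∷ A) ⊆ image (f ∘ suc) A
  ⊆-tail x∈ with ∈-image⁻ f (outside ∷ A) x∈
  ... | suc i , there i∈A , refl = ∈-image⁺ (f ∘ suc) i∈A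
∣image∣≤ f (inside ∷ A) = ℕₚ.≤-trans (p⊆q⇒∣p∣≤∣q∣ ⊆-tail)
  (ℕₚ.≤-trans (∣⁅x⁆∪p∣≤1+∣p∣ (f zero) _) (ℕ.s≤s (∣image∣≤ (f ∘ suc) A)))
  where
  ⊆-tail : image f (inside ∷ A) ⊆ ⁅ f zero ⁆ ∪ image (f ∘ suc) A
  ⊆-tail x∈ with ∈-image⁻ f (inside ∷ A) x∈
  ... | zero  , here      , refl = x∈p∪q⁺ (inj₁ (x∈⁅x⁆ (f zero)))
  ... | suc i , there i∈A , refl = x∈p∪q⁺ (inj₂ (∈-image⁺ (f ∘ suc) i∈A))

tabulate-∈? : ∀ {n} (F : Subset n) → Vec.tabulate (does ∘ (_∈? F)) ≡ F
tabulate-∈? []            = refl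
tabulate-∈? (inside  ∷ F) = cong (inside ∷_) (tabulate-∈? F)
tabulate-∈? (outside ∷ F) = cong (outside ∷_) (tabulate-∈? F)

lengthAt : ∀ {G} → LengthFunction G → ℕ → E G → ℚ
lengthAt ℓ n e = seq (length ℓ e) n

-- Reduces every estimate of lengths to rational sums at a fixed index. The local `go` admits any
-- predicate and any enumeration `g`, because the induction peels the first edge off `tabulate g`.
seq-totalLength : ∀ {G} (ℓ : LengthFunction G) F n →
  seq (totalLength ℓ F) n ≡ sumOver (lengthAt ℓ n) F
seq-totalLength {G} ℓ F n =
  trans (go (_∈? F) id) (cong (sumOver (lengthAt ℓ n)) (tabulate-∈? F))
  where
  go : ∀ {m} {P : E G → Set} (P? : Decidable P) (g : Fin m → E G) →
    seq (foldr _+_ 0ℝ (map (length ℓ) (filter P? (tabulate g)))) n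
      ≡ sumOver (lengthAt ℓ n ∘ g) (Vec.tabulate (does ∘ P? ∘ g))
  go {ℕ.zero}  P? g = refl
  go {ℕ.suc m} P? g with does (P? (g zero))
  ... | inside  = cong (lengthAt ℓ n (g zero) ℚ.+_) (go P? (g ∘ suc))
  ... | outside = go P? (g ∘ suc)

-- A positive real may begin with negative rationals, so this can only hold from some index on; as
-- there are finitely many edges, one index serves all.
lengthAt-nonneg : ∀ {G} (ℓ : LengthFunction G) → Eventually λ n → ∀ e → 0ℚ ℚ.≤ lengthAt ℓ n e
lengthAt-nonneg ℓ = eventually-all λ e →
  let δ , 0<δ , ev = positive ℓ e in
  eventually-map (λ n → ℚₚ.≤-trans (ℚₚ.≤-trans (ℚₚ.<⇒≤ 0<δ) (ℚₚ.≤-reflexive (sym (ℚₚ.+-identityˡ δ))))) ev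

totalLength-≲⁺ : ∀ {G G′} (ℓ : LengthFunction G) (ℓ′ : LengthFunction G′) F F′ {δ} →
  Eventually (λ n → sumOver (lengthAt ℓ n) F ℚ.≤ sumOver (lengthAt ℓ′ n) F′ ℚ.+ δ) →
  totalLength ℓ F ≲[ δ ] totalLength ℓ′ F′
totalLength-≲⁺ ℓ ℓ′ F F′ {δ} = eventually-map λ n → subst₂ (λ x y → x ℚ.≤ y ℚ.+ δ)
  (sym (seq-totalLength ℓ F n)) (sym (seq-totalLength ℓ′ F′ n))

totalLength-≲⁻ : ∀ {G G′} (ℓ : LengthFunction G) (ℓ′ : LengthFunction G′) F F′ {δ} →
  totalLength ℓ F ≲[ δ ] totalLength ℓ′ F′ →
  Eventually (λ n → sumOver (lengthAt ℓ n) F ℚ.≤ sumOver (lengthAt ℓ′ n) F′ ℚ.+ δ)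
totalLength-≲⁻ ℓ ℓ′ F F′ {δ} = eventually-map λ n → subst₂ (λ x y → x ℚ.≤ y ℚ.+ δ)
  (seq-totalLength ℓ F n) (seq-totalLength ℓ′ F′ n)

-- Connected subgraphs and Steiner distance

ConnectedSubgraph : (G : Graph) → Subset (#V G) → Subset (#E G) → Set
ConnectedSubgraph G X F = IsSubgraph G X F × IsConnected G X F

∈-inducedEdges⁻ : ∀ G X {e} → e ∈ inducedEdges G X → end₁ G e ∈ X × end₂ G e ∈ X
∈-inducedEdges⁻ G X = ∈-comprehension⁻ (λ e → (end₁ G e ∈? X) ×-dec (end₂ G e ∈? X))

∈-inducedEdges⁺ : ∀ G X {e} → end₁ G e ∈ X × end₂ G e ∈ X → e ∈ inducedEdges G X
∈-inducedEdges⁺ G X = ∈-comprehension⁺ (λ e → (end₁ G e ∈? X) ×-dec (end₂ G e ∈? X))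

joins-sym : ∀ G {e u v} → Joins G e u v → Joins G e v u
joins-sym G = swap

joins-unique : ∀ G {e u v x y} → Joins G e u v → Joins G e x y →
  (x ≡ u × y ≡ v) ⊎ (x ≡ v × y ≡ u)
joins-unique G (inj₁ (refl , refl)) (inj₁ (refl , refl)) = inj₁ (refl , refl)
joins-unique G (inj₁ (refl , refl)) (inj₂ (refl , refl)) = inj₂ (refl , refl)
joins-unique G (inj₂ (refl , refl)) (inj₁ (refl , refl)) = inj₂ (refl , refl)
joins-unique G (inj₂ (refl , refl)) (inj₂ (refl , refl)) = inj₁ (refl , refl)

joins-∈ : ∀ G {X e u v} → Joins G e u v → u ∈ X → v ∈ X → end₁ G e ∈ X × end₂ G e ∈ X
joins-∈ G (inj₁ (refl , refl)) u∈X v∈X = u∈X , v∈X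
joins-∈ G (inj₂ (refl , refl)) u∈X v∈X = v∈X , u∈X

walk-sym : ∀ G {F u v} → Star (Adjacent G F) u v → Star (Adjacent G F) v u
walk-sym G = Star.reverse λ (e , e∈F , j) → e , e∈F , joins-sym G j

walk-⊆ : ∀ G {F K u v} → F ⊆ K → Star (Adjacent G F) u v → Star (Adjacent G K) u v
walk-⊆ G F⊆K = Star.map λ (e , e∈F , j) → e , F⊆K e∈F , j

connected-to : ∀ G {X F} r → (∀ {u} → u ∈ X → Star (Adjacent G F) u r) →
  ∀ u v → u ∈ X → v ∈ X → Star (Adjacent G F) u v
connected-to G r to u v u∈X v∈X = to u∈X ◅◅ walk-sym G (to v∈X)

single-vertex : ∀ G v → ConnectedSubgraph G ⁅ v ⁆ ⊥
single-vertex G v = (λ e e∈ → ⊥-elim (∉⊥ e∈)) , (v , x∈⁅x⁆ v) ,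
  λ x y x∈ y∈ → subst₂ (Star _) (sym (x∈⁅y⁆⇒x≡y v x∈)) (sym (x∈⁅y⁆⇒x≡y v y∈)) ε

-- The common form of embedding a subgraph, collapsing branch sets and projecting the glued graph.
-- The first condition carries walks over, an edge with identified ends becoming an empty walk; the
-- second keeps the ends of `M` in the image.
quotient-connected : ∀ {H K} (π : V H → V K) {X F M} → ConnectedSubgraph H X F →
  (∀ h → h ∈ F → π (end₁ H h) ≡ π (end₂ H h)
                 ⊎ ∃ λ m → m ∈ M × Joins K m (π (end₁ H h)) (π (end₂ H h))) →
  (∀ m → m ∈ M → ∃ λ h → h ∈ F × Joins K m (π (end₁ H h)) (π (end₂ H h))) →
  ConnectedSubgraph K (image π X) M
quotient-connected {H} {K} π {X} {F} {M} (sub , (x , x∈X) , conn) down up =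
  sub′ , (π x , ∈-image⁺ π x∈X) , conn′
  where
  sub′ : IsSubgraph K (image π X) M
  sub′ m m∈M =
    let h , h∈F , j = up m m∈M
        p , q = sub h h∈F
    in joins-∈ K j (∈-image⁺ π p) (∈-image⁺ π q)
  step : ∀ {u v} → Adjacent H F u v → Star (Adjacent K M) (π u) (π v)
  step (h , h∈F , inj₁ (refl , refl)) with down h h∈F
  ... | inj₁ eq            = subst (Star _ _) eq ε
  ... | inj₂ (m , m∈M , j) = (m , m∈M , j) ◅ ε
  step (h , h∈F , inj₂ (refl , refl)) with down h h∈F
  ... | inj₁ eq            = subst (Star _ _) (sym eq) ε
  ... | inj₂ (m , m∈M , j) = (m , m∈M , joins-sym K j) ◅ ε
  conn′ : ∀ u v → u ∈ image π X → v ∈ image π X → Star (Adjacent K M) u v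
  conn′ u v u∈ v∈ with ∈-image⁻ π X u∈ | ∈-image⁻ π X v∈
  ... | u′ , u′∈ , refl | v′ , v′∈ , refl = Star.kleisliStar π step (conn u′ v′ u′∈ v′∈)

pushforward-connected : ∀ {H K} (ι : H ↪ K) {X F} → ConnectedSubgraph H X F →
  ConnectedSubgraph K (image (vmap ι) X) (image (emap ι) F)
pushforward-connected {H} {K} ι {X} {F} c = quotient-connected {H} {K} (vmap ι) c
  (λ h h∈F → inj₂ (emap ι h , ∈-image⁺ (emap ι) h∈F , incidence ι h)) up
  where
  up : ∀ m → m ∈ image (emap ι) F →
    ∃ λ h → h ∈ F × Joins K m (vmap ι (end₁ H h)) (vmap ι (end₂ H h))
  up m m∈ with ∈-image⁻ (emap ι) F m∈
  ... | h , h∈F , refl = h , h∈F , incidence ι h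

-- A walk that starts in `H` never leaves it, as each of its edges comes from `H`; injectivity of
-- `vmap ι` identifies the vertices along the way.
pullback-connected : ∀ {H K} (ι : H ↪ K) {X F} → ConnectedSubgraph K X F →
  (∀ f → f ∈ F → ∃ λ h → emap ι h ≡ f) → (∃ λ u → vmap ι u ∈ X) →
  ConnectedSubgraph H (preimage (vmap ι) X) (preimage (emap ι) F)
pullback-connected {H} {K} ι {X} {F} (sub , _ , conn) covered (x , x∈X) =
  sub′ , (x , ∈-preimage⁺ (vmap ι) x∈X) ,
  λ u v u∈ v∈ → walk (conn _ _ (∈-preimage⁻ (vmap ι) X u∈) (∈-preimage⁻ (vmap ι) X v∈)) refl refl
  where
  sub′ : IsSubgraph H (preimage (vmap ι) X) (preimage (emap ι) F)
  sub′ h h∈ with sub (emap ι h) (∈-preimage⁻ (emap ι) F h∈) | incidence ι h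
  ... | p , q | inj₁ (e₁ , e₂) =
    ∈-preimage⁺ (vmap ι) (subst (_∈ X) e₁ p) , ∈-preimage⁺ (vmap ι) (subst (_∈ X) e₂ q)
  ... | p , q | inj₂ (e₁ , e₂) =
    ∈-preimage⁺ (vmap ι) (subst (_∈ X) e₂ q) , ∈-preimage⁺ (vmap ι) (subst (_∈ X) e₁ p)
  walk : ∀ {a b} → Star (Adjacent K F) a b → ∀ {u v} → a ≡ vmap ι u → b ≡ vmap ι v →
    Star (Adjacent H (preimage (emap ι) F)) u v
  walk ε a≡ b≡ = subst (Star _ _) (vmap-injective ι (trans (sym a≡) b≡)) ε
  walk ((f , f∈F , j) ◅ s) refl b≡ with covered f f∈F
  ... | h , refl with joins-unique K (incidence ι h) j
  ... | inj₁ (u≡ , c≡) = (h , ∈-preimage⁺ (emap ι) f∈F , inj₁ (sym (vmap-injective ι u≡) , refl))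
    ◅ walk s c≡ b≡
  ... | inj₂ (u≡ , c≡) = (h , ∈-preimage⁺ (emap ι) f∈F , inj₂ (refl , sym (vmap-injective ι u≡)))
    ◅ walk s c≡ b≡

-- Vertices of `X` are linked through representatives: each walks to some `r y`, and a walk of `K`
-- between two such `y` is expanded edge by edge.
blowup-connected : ∀ {H K} (r : V K → V H) {X F Y M} → IsConnected K Y M →
  (∀ {y} → y ∈ Y → r y ∈ X) →
  (∀ {u} → u ∈ X → ∃ λ y → y ∈ Y × Star (Adjacent H F) u (r y)) →
  (∀ {y z} → Adjacent K M y z → Star (Adjacent H F) (r y) (r z)) →
  IsConnected H X F
blowup-connected {H} r ((y , y∈Y) , conn) r∈X to step =
  (r y , r∈X y∈Y) , connected-to H (r y) λ u∈X →
    let z , z∈Y , s = to u∈X in s ◅◅ Star.kleisliStar r step (conn z y z∈Y y∈Y)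

-- Expresses that the Steiner distance of `A` in `H` is at most that in `G`, without mentioning
-- minima or infinity. The reverse inequality holds for every embedding, since a connected subgraph
-- of `H` is also one of `G`.
Approximable : ∀ {H G} → H ↪ G → LengthFunction G → Subset (#V H) → Set
Approximable {H} {G} ι ℓ A = ∀ {X F} → ConnectedSubgraph G X F → (∀ {a} → a ∈ A → vmap ι a ∈ X) →
  ∀ δ → 0ℚ ℚ.< δ → ∃₂ λ Y K → ConnectedSubgraph H Y K × A ⊆ Y ×
    Eventually (λ n → sumOver (lengthAt (restrict ι ℓ) n) K ℚ.≤ sumOver (lengthAt ℓ n) F ℚ.+ δ)

∈-allSubsets : ∀ {n} (X : Subset n) → X List.∈ allSubsets n
∈-allSubsets []            = here refl
∈-allSubsets (inside  ∷ X) = ∈-++⁺ˡ (∈-map⁺ (inside ∷_) (∈-allSubsets X))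
∈-allSubsets {ℕ.suc n} (outside ∷ X) =
  ∈-++⁺ʳ (map (inside ∷_) (allSubsets n)) (∈-map⁺ (outside ∷_) (∈-allSubsets X))

connectedSubgraphsOn : (G : Graph) → Subset (#V G) → List (Subset (#V G) × Subset (#E G))
connectedSubgraphsOn G A = filter (Graph.isConnectedSubgraphOn? G A)
  (cartesianProduct (allSubsets (#V G)) (allSubsets (#E G)))

∈-lengths⁺ : ∀ G (ℓ : LengthFunction G) {A X F} → ConnectedSubgraph G X F → A ⊆ X →
  totalLength ℓ F List.∈ map (totalLength ℓ ∘ proj₂) (connectedSubgraphsOn G A)
∈-lengths⁺ G ℓ {A} {X} {F} (sub , conn) A⊆X = ∈-map⁺ (totalLength ℓ ∘ proj₂)
  (∈-filter⁺ (Graph.isConnectedSubgraphOn? G A)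
    (∈-cartesianProduct⁺ (∈-allSubsets X) (∈-allSubsets F)) (sub , conn , A⊆X))

∈-lengths⁻ : ∀ G (ℓ : LengthFunction G) {A x} →
  x List.∈ map (totalLength ℓ ∘ proj₂) (connectedSubgraphsOn G A) →
  ∃₂ λ X F → ConnectedSubgraph G X F × A ⊆ X × x ≡ totalLength ℓ F
∈-lengths⁻ G ℓ {A} x∈ with ∈-map⁻ (totalLength ℓ ∘ proj₂) x∈
... | (X , F) , XF∈ , eq
  with ∈-filter⁻ (Graph.isConnectedSubgraphOn? G A)
         {xs = cartesianProduct (allSubsets (#V G)) (allSubsets (#E G))} XF∈
... | _ , (sub , conn , A⊆X) = X , F , (sub , conn) , A⊆X , eq

sd-≈⇒approximable : ∀ {H G} (ι : H ↪ G) (ℓ : LengthFunction G) A →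
  sd H (restrict ι ℓ) A ≈∞ sd G ℓ (image (vmap ι) A) → Approximable ι ℓ A
sd-≈⇒approximable {H} {G} ι ℓ A h {X} {F} c ιA⊆X δ 0<δ
  with minimum-≈⇒dominated h (∈-lengths⁺ G ℓ c image⊆X) δ 0<δ
  where
  image⊆X : image (vmap ι) A ⊆ X
  image⊆X v∈ with ∈-image⁻ (vmap ι) A v∈
  ... | a , a∈A , refl = ιA⊆X a∈A
... | x , x∈ , x≲ with ∈-lengths⁻ H (restrict ι ℓ) x∈
... | Y , K , c′ , A⊆Y , refl = Y , K , c′ , A⊆Y , totalLength-≲⁻ (restrict ι ℓ) ℓ K F x≲

approximable⇒sd-≈ : ∀ {H G} (ι : H ↪ G) (ℓ : LengthFunction G) A →
  Approximable ι ℓ A → sd H (restrict ι ℓ) A ≈∞ sd G ℓ (image (vmap ι) A)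
approximable⇒sd-≈ {H} {G} ι ℓ A approx = minimum-≈ below above
  where
  below : Dominated (map (totalLength (restrict ι ℓ) ∘ proj₂) (connectedSubgraphsOn H A))
    (map (totalLength ℓ ∘ proj₂) (connectedSubgraphsOn G (image (vmap ι) A)))
  below y∈ δ 0<δ with ∈-lengths⁻ G ℓ y∈
  ... | X , F , c , A⊆X , refl with approx c (λ a∈A → A⊆X (∈-image⁺ (vmap ι) a∈A)) δ 0<δ
  ... | Y , K , c′ , A⊆Y , K≲F = _ , ∈-lengths⁺ H (restrict ι ℓ) c′ A⊆Y ,
    totalLength-≲⁺ (restrict ι ℓ) ℓ K F K≲F
  above : Dominated (map (totalLength ℓ ∘ proj₂) (connectedSubgraphsOn G (image (vmap ι) A)))
    (map (totalLength (restrict ι ℓ) ∘ proj₂) (connectedSubgraphsOn H A))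
  above x∈ δ 0<δ with ∈-lengths⁻ H (restrict ι ℓ) x∈
  ... | Y , K , c , A⊆Y , refl = _ , ∈-lengths⁺ G ℓ (pushforward-connected ι c) image⊆ ,
    totalLength-≲⁺ ℓ (restrict ι ℓ) (image (emap ι) K) K (eventually-map
      (λ n w≥0 → ℚₚ.≤-trans (sumOver-image {w = lengthAt ℓ n} (w≥0 ∘ emap ι) (emap ι) (λ _ → refl) K)
        (x≤x+y _ (ℚₚ.<⇒≤ 0<δ)))
      (lengthAt-nonneg ℓ))
    where
    image⊆ : image (vmap ι) A ⊆ image (vmap ι) Y
    image⊆ v∈ with ∈-image⁻ (vmap ι) A v∈
    ... | a , a∈A , refl = ∈-image⁺ (vmap ι) (A⊆Y a∈A)

ℋ′ : ℕ → Graph → Set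
ℋ′ k H = (G : Graph) (ι : H ↪ G) (ℓ : LengthFunction G) →
  (∀ A → ∣ A ∣ ≤ k → Approximable ι ℓ A) → ∀ A → Approximable ι ℓ A

ℋ⇒ℋ′ : ∀ {k H} → ℋ k H → ℋ′ k H
ℋ⇒ℋ′ h G ι ℓ approx A = sd-≈⇒approximable ι ℓ A
  (h G ι ℓ (λ B B≤k → approximable⇒sd-≈ ι ℓ B (approx B B≤k)) ∣ A ∣ A ℕₚ.≤-refl)

ℋ′⇒ℋ : ∀ {k H} → ℋ′ k H → ℋ k H
ℋ′⇒ℋ h G ι ℓ geo _ A _ = approximable⇒sd-≈ ι ℓ A
  (h G ι ℓ (λ B B≤k → sd-≈⇒approximable ι ℓ B (geo B B≤k)) A)

-- Deleting an edge

constant : ℚ → ℝ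
constant q = mkℝ (λ _ → q) λ δ 0<δ → 0 , λ _ _ _ _ →
  subst (ℚ._< δ) (sym (cong ℚ.∣_∣ (ℚₚ.+-inverseʳ q))) 0<δ

constant-positive : ∀ {q} → 0ℚ ℚ.< q → 0ℝ < constant q
constant-positive {q} 0<q = q , 0<q , always λ _ → ℚₚ.≤-reflexive (ℚₚ.+-identityˡ q)

+constant-positive : ∀ {x q} → Eventually (λ n → 0ℚ ℚ.≤ seq x n) → 0ℚ ℚ.< q → 0ℝ < x + constant q
+constant-positive {x} {q} x≥0 0<q = q , 0<q , eventually-map (λ n → ℚₚ.+-monoˡ-≤ q) x≥0

component : (G : Graph) → Subset (#V G) → Subset (#E G) → V G → Subset (#V G)
component G X F r = comprehension (λ v → (v ∈? X) ×-dec star? G F v r)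

∈-component⁺ : ∀ G {X F r v} → v ∈ X → Star (Adjacent G F) v r → v ∈ component G X F r
∈-component⁺ G {X} {F} {r} v∈X s = ∈-comprehension⁺ (λ v → (v ∈? X) ×-dec star? G F v r) (v∈X , s)

∈-component⁻ : ∀ G X F r {v} → v ∈ component G X F r → v ∈ X × Star (Adjacent G F) v r
∈-component⁻ G X F r = ∈-comprehension⁻ (λ v → (v ∈? X) ×-dec star? G F v r)

-- Testing one end is enough: the edge itself links its other end to the same component.
componentEdges : (G : Graph) → Subset (#V G) → Subset (#E G) → V G → Subset (#E G)
componentEdges G X F r = comprehension (λ f → (f ∈? F) ×-dec (end₁ G f ∈? component G X F r))

∈-componentEdges⁻ : ∀ G X F r {f} → f ∈ componentEdges G X F r → f ∈ F × end₁ G f ∈ component G X F r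
∈-componentEdges⁻ G X F r = ∈-comprehension⁻ (λ f → (f ∈? F) ×-dec (end₁ G f ∈? component G X F r))

component-connected : ∀ G {X F r} → IsSubgraph G X F → r ∈ X →
  ConnectedSubgraph G (component G X F r) (componentEdges G X F r)
component-connected G {X} {F} {r} sub r∈X =
  sub′ , (r , ∈-component⁺ G r∈X ε) ,
  connected-to G r (λ u∈ → walk (proj₂ (∈-component⁻ G X F r u∈)))
  where
  sub′ : IsSubgraph G (component G X F r) (componentEdges G X F r)
  sub′ f f∈ with ∈-componentEdges⁻ G X F r f∈
  ... | f∈F , p = p , ∈-component⁺ G (proj₂ (sub f f∈F))
    ((f , f∈F , inj₂ (refl , refl)) ◅ proj₂ (∈-component⁻ G X F r p))
  walk : ∀ {u} → Star (Adjacent G F) u r → Star (Adjacent G (componentEdges G X F r)) u r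
  walk ε = ε
  walk s₀@((f , f∈F , j) ◅ s) = (f , ∈-comprehension⁺
    (λ f → (f ∈? F) ×-dec (end₁ G f ∈? component G X F r)) (f∈F , end₁∈ j) , j) ◅ walk s
    where
    end₁∈ : Joins G f _ _ → end₁ G f ∈ component G X F r
    end₁∈ (inj₁ (refl , _)) = ∈-component⁺ G (proj₁ (sub f f∈F)) s₀
    end₁∈ (inj₂ (refl , _)) = ∈-component⁺ G (proj₁ (sub f f∈F)) s

punchIn-cover : ∀ {n} (e h : Fin (ℕ.suc n)) → e ≡ h ⊎ ∃ λ d → punchIn e d ≡ h
punchIn-cover e h with e ≟ h
... | yes e≡h = inj₁ e≡h
... | no  e≢h = inj₂ (punchOut e≢h , punchIn-punchOut e≢h)

-- The count in the bridge case: `p` consists of the terminals on one side, and a terminal `y` on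
-- the other side makes room for the end `x` of the bridge.
∣⁅x⁆∪p∣≤∣q∣ : ∀ {n} x {p q : Subset n} → p ⊆ q → (∃ λ y → y ∈ q × ¬ y ∈ p) → ∣ ⁅ x ⁆ ∪ p ∣ ≤ ∣ q ∣
∣⁅x⁆∪p∣≤∣q∣ x {p} p⊆q w = ℕₚ.≤-trans (∣⁅x⁆∪p∣≤1+∣p∣ x p) (p⊂q⇒∣p∣<∣q∣ (p⊆q , w))

-- The graph is given by its components so that its number of edges is literally `suc n`;
-- `punchIn e` then enumerates the edges other than `e`.
module EdgeDeletion {v n : ℕ} (e₁ e₂ : Fin (ℕ.suc n) → Fin v) (e₁≢e₂ : ∀ h → e₁ h ≢ e₂ h)
  (e : Fin (ℕ.suc n)) where

  H : Graph
  H = record { #V = v ; #E = ℕ.suc n ; end₁ = e₁ ; end₂ = e₂ ; loopless = e₁≢e₂ }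

  D : Graph
  D = record { #V = v ; #E = n ; end₁ = e₁ ∘ punchIn e ; end₂ = e₂ ∘ punchIn e
             ; loopless = e₁≢e₂ ∘ punchIn e }

  D↪H : D ↪ H
  D↪H = record { vmap = id ; emap = punchIn e ; vmap-injective = id
               ; emap-injective = punchIn-injective e _ _ ; incidence = λ _ → inj₁ (refl , refl) }

  module Extension {G : Graph} (ι : D ↪ G) (ℓ : LengthFunction G) where

    x̂ ŷ : V G
    x̂ = vmap ι (e₁ e)
    ŷ = vmap ι (e₂ e)

    -- The copy of `e` is edge `zero`. An edge set of `G⁺` is thus a bit for `e` followed by an edge
    -- set of `G`, which the patterns `inside ∷ F` and `outside ∷ F` exploit.
    end₁⁺ end₂⁺ : Fin (ℕ.suc (#E G)) → V G
    end₁⁺ zero    = x̂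
    end₁⁺ (suc f) = end₁ G f
    end₂⁺ zero    = ŷ
    end₂⁺ (suc f) = end₂ G f

    loopless⁺ : ∀ f → end₁⁺ f ≢ end₂⁺ f
    loopless⁺ zero    = e₁≢e₂ e ∘ vmap-injective ι
    loopless⁺ (suc f) = loopless G f

    G⁺ : Graph
    G⁺ = record { #V = #V G ; #E = ℕ.suc (#E G) ; end₁ = end₁⁺ ; end₂ = end₂⁺ ; loopless = loopless⁺ }

    emap⁺ : E H → E G⁺
    emap⁺ h with e ≟ h
    ... | yes _   = zero
    ... | no  e≢h = suc (emap ι (punchOut e≢h))

    emap⁺-e : emap⁺ e ≡ zero
    emap⁺-e with e ≟ e
    ... | yes _  = refl
    ... | no e≢e = ⊥-elim (e≢e refl)

    emap⁺-punchIn : ∀ d → emap⁺ (punchIn e d) ≡ suc (emap ι d)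
    emap⁺-punchIn d with e ≟ punchIn e d
    ... | yes eq  = ⊥-elim (punchInᵢ≢i e d (sym eq))
    ... | no  neq = cong (suc ∘ emap ι) (punchIn-injective e _ _ (punchIn-punchOut neq))

    emap⁺-injective : ∀ {h h′} → emap⁺ h ≡ emap⁺ h′ → h ≡ h′
    emap⁺-injective {h} {h′} eq with punchIn-cover e h | punchIn-cover e h′
    ... | inj₁ refl       | inj₁ refl        = refl
    ... | inj₁ refl       | inj₂ (d′ , refl) =
      ⊥-elim (0≢1+n (trans (sym emap⁺-e) (trans eq (emap⁺-punchIn d′))))
    ... | inj₂ (d , refl) | inj₁ refl        =
      ⊥-elim (0≢1+n (trans (sym emap⁺-e) (trans (sym eq) (emap⁺-punchIn d))))
    ... | inj₂ (d , refl) | inj₂ (d′ , refl) = cong (punchIn e) (emap-injective ι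
      (suc-injective (trans (sym (emap⁺-punchIn d)) (trans eq (emap⁺-punchIn d′)))))

    incidence⁺ : ∀ h → Joins G⁺ (emap⁺ h) (vmap ι (e₁ h)) (vmap ι (e₂ h))
    incidence⁺ h with punchIn-cover e h
    ... | inj₁ refl = subst (λ f → Joins G⁺ f x̂ ŷ) (sym emap⁺-e) (inj₁ (refl , refl))
    ... | inj₂ (d , refl) =
      subst (λ f → Joins G⁺ f _ _) (sym (emap⁺-punchIn d)) (incidence ι d)

    ι⁺ : H ↪ G⁺
    ι⁺ = record { vmap = vmap ι ; emap = emap⁺ ; vmap-injective = vmap-injective ι
                ; emap-injective = emap⁺-injective ; incidence = incidence⁺ }

    -- Too long to be used by any subgraph competing with one of G.
    length⁺ : E G⁺ → ℝ
    length⁺ zero    = totalLength ℓ ⊤ + constant 1ℚ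
    length⁺ (suc f) = length ℓ f

    totalLength-nonneg : ∀ F → Eventually λ m → 0ℚ ℚ.≤ seq (totalLength ℓ F) m
    totalLength-nonneg F = eventually-map
      (λ m w≥0 → ℚₚ.≤-trans (sumOver-nonneg w≥0 F) (ℚₚ.≤-reflexive (sym (seq-totalLength ℓ F m))))
      (lengthAt-nonneg ℓ)

    positive⁺ : ∀ f → 0ℝ < length⁺ f
    positive⁺ zero    = +constant-positive {totalLength ℓ ⊤} (totalLength-nonneg ⊤) (ℚₚ.positive⁻¹ 1ℚ)
    positive⁺ (suc f) = positive ℓ f

    ℓ⁺ : LengthFunction G⁺
    ℓ⁺ = record { length = length⁺ ; positive = positive⁺ }

    wᴴ : ℕ → E H → ℚ
    wᴴ = lengthAt (restrict ι⁺ ℓ⁺)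

    wᴰ : ℕ → E D → ℚ
    wᴰ = lengthAt (restrict ι ℓ)

    wᴴ-e : ∀ m → wᴴ m e ≡ lengthAt ℓ⁺ m zero
    wᴴ-e m = cong (lengthAt ℓ⁺ m) emap⁺-e

    wᴴ-punchIn : ∀ m d → wᴴ m (punchIn e d) ≡ wᴰ m d
    wᴴ-punchIn m d = cong (lengthAt ℓ⁺ m) (emap⁺-punchIn d)

    sumOver-tail : ∀ {m} → (∀ f → 0ℚ ℚ.≤ lengthAt ℓ⁺ m f) → ∀ b F →
      sumOver (lengthAt ℓ m) F ℚ.≤ sumOver (lengthAt ℓ⁺ m) (b ∷ F)
    sumOver-tail w≥0 inside  F = y≤x+y _ (w≥0 zero)
    sumOver-tail w≥0 outside F = ℚₚ.≤-refl

    drop-walk : ∀ {F u w} → Star (Adjacent G⁺ (outside ∷ F)) u w → Star (Adjacent G F) u w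
    drop-walk = Star.map λ { (suc f , there f∈F , j) → f , f∈F , j }

    -- Cut the walk where it first uses `e`: that vertex is an end of `e`, and everything before
    -- lies in `G`.
    reach : ∀ {F u w} → Star (Adjacent G⁺ (inside ∷ F)) u w → w ≡ x̂ →
      Star (Adjacent G F) u x̂ ⊎ Star (Adjacent G F) u ŷ
    reach ε refl = inj₁ ε
    reach ((zero , _ , inj₁ (refl , _)) ◅ _) _ = inj₁ ε
    reach ((zero , _ , inj₂ (_ , refl)) ◅ _) _ = inj₂ ε
    reach ((suc f , there f∈F , j) ◅ s) eq with reach s eq
    ... | inj₁ t = inj₁ ((f , f∈F , j) ◅ t)
    ... | inj₂ t = inj₂ ((f , f∈F , j) ◅ t)

    module Approximation {k : ℕ} (approx : ∀ B → ∣ B ∣ ≤ k → Approximable ι ℓ B)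
      {A : Subset v} (∣A∣≤k : ∣ A ∣ ≤ k) where

      Goal : ∀ F → ℚ → Set
      Goal F δ = ∃₂ λ Y K → ConnectedSubgraph H Y K × A ⊆ Y ×
        Eventually (λ m → sumOver (wᴴ m) K ℚ.≤ sumOver (lengthAt ℓ⁺ m) F ℚ.+ δ)

      -- Handles all cases that can do without `e`. The bit `b` tells whether the competing subgraph
      -- contains `e`, whose length is simply given away; `F` may be smaller than `F′`, as when only
      -- one component is kept.
      transfer : ∀ {X F} → ConnectedSubgraph G X F → (∀ {a} → a ∈ A → vmap ι a ∈ X) →
        ∀ b {F′} → F ⊆ F′ → ∀ δ → 0ℚ ℚ.< δ → Goal (b ∷ F′) δ
      transfer {X} {F} c A⊆X b {F′} F⊆F′ δ 0<δ with approx A ∣A∣≤k c A⊆X δ 0<δ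
      ... | Y , K , c′ , A⊆Y , K≲F = image id Y , image (punchIn e) K , pushforward-connected D↪H c′ ,
        (λ a∈A → ∈-image⁺ id (A⊆Y a∈A)) ,
        eventually-zip estimate (lengthAt-nonneg ℓ⁺) K≲F
        where
        estimate : ∀ m → (∀ f → 0ℚ ℚ.≤ lengthAt ℓ⁺ m f) →
          sumOver (wᴰ m) K ℚ.≤ sumOver (lengthAt ℓ m) F ℚ.+ δ →
          sumOver (wᴴ m) (image (punchIn e) K) ℚ.≤ sumOver (lengthAt ℓ⁺ m) (b ∷ F′) ℚ.+ δ
        estimate m w≥0 K≤F = ℚₚ.≤-trans
          (sumOver-image {w = wᴴ m} (λ d → w≥0 (suc (emap ι d))) (punchIn e) (wᴴ-punchIn m) K)
          (ℚₚ.≤-trans K≤F (ℚₚ.+-monoˡ-≤ δ (ℚₚ.≤-trans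
            (sumOver-mono (w≥0 ∘ suc) F⊆F′ (λ _ _ → ℚₚ.≤-refl)) (sumOver-tail w≥0 b F′))))

      module Separated {X : Subset (#V G)} {F : Subset (#E G)} (sub : IsSubgraph G X F) (x̂∈X : x̂ ∈ X) (ŷ∈X : ŷ ∈ X)
        (reaches : ∀ {u} → u ∈ X → Star (Adjacent G F) u x̂ ⊎ Star (Adjacent G F) u ŷ)
        (separated : ¬ Star (Adjacent G F) x̂ ŷ) (A⊆X : ∀ {a} → a ∈ A → vmap ι a ∈ X)
        (δ : ℚ) (0<δ : 0ℚ ℚ.< δ) where

        side : V G → Subset v
        side r = comprehension (λ a → (a ∈? A) ×-dec star? G F (vmap ι a) r)

        ∈-side⁻ : ∀ r {a} → a ∈ side r → a ∈ A × Star (Adjacent G F) (vmap ι a) r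
        ∈-side⁻ r = ∈-comprehension⁻ (λ a → (a ∈? A) ×-dec star? G F (vmap ι a) r)

        ∈-side⁺ : ∀ r {a} → a ∈ A → Star (Adjacent G F) (vmap ι a) r → a ∈ side r
        ∈-side⁺ r a∈A s = ∈-comprehension⁺ (λ a → (a ∈? A) ×-dec star? G F (vmap ι a) r) (a∈A , s)

        sides : ∀ {a} → a ∈ A → a ∈ side x̂ ⊎ a ∈ side ŷ
        sides a∈A with reaches (A⊆X a∈A)
        ... | inj₁ s = inj₁ (∈-side⁺ x̂ a∈A s)
        ... | inj₂ s = inj₂ (∈-side⁺ ŷ a∈A s)

        -- Here an added end of `e` could push the number of terminals to `k + 1`; instead `e` and
        -- the other component are discarded.
        one-sided : ∀ {r} → r ∈ X → (∀ {a} → a ∈ A → a ∈ side r) → Goal (inside ∷ F) δ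
        one-sided {r} r∈X A⊆side = transfer (component-connected G sub r∈X)
          (λ a∈A → ∈-component⁺ G (A⊆X a∈A) (proj₂ (∈-side⁻ r (A⊆side a∈A))))
          inside (λ f∈ → proj₁ (∈-componentEdges⁻ G X F r f∈)) δ 0<δ

        -- The end `x` of `e` becomes a terminal so that the two partial solutions can be linked by
        -- `e`; each of them gets half of the slack.
        half-approximation : ∀ x → vmap ι x ∈ X → ∣ ⁅ x ⁆ ∪ side (vmap ι x) ∣ ≤ k →
          ∃₂ λ Y K → ConnectedSubgraph D Y K × ⁅ x ⁆ ∪ side (vmap ι x) ⊆ Y ×
            Eventually (λ m → sumOver (wᴰ m) K
              ℚ.≤ sumOver (lengthAt ℓ m) (componentEdges G X F (vmap ι x)) ℚ.+ ½ ℚ.* δ)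
        half-approximation x x∈X B≤k =
          approx (⁅ x ⁆ ∪ side (vmap ι x)) B≤k (component-connected G sub x∈X) B⊆ (½ ℚ.* δ) (half-positive 0<δ)
          where
          B⊆ : ∀ {a} → a ∈ ⁅ x ⁆ ∪ side (vmap ι x) → vmap ι a ∈ component G X F (vmap ι x)
          B⊆ a∈ with x∈p∪q⁻ ⁅ x ⁆ (side (vmap ι x)) a∈
          ... | inj₁ a∈x rewrite x∈⁅y⁆⇒x≡y x a∈x = ∈-component⁺ G x∈X ε
          ... | inj₂ a∈s with ∈-side⁻ (vmap ι x) a∈s
          ... | a∈A , s = ∈-component⁺ G (A⊆X a∈A) s

        join : ∀ {Y₁ K₁ Y₂ K₂} → ConnectedSubgraph D Y₁ K₁ → ConnectedSubgraph D Y₂ K₂ →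
          e₁ e ∈ Y₁ → e₂ e ∈ Y₂ →
          ConnectedSubgraph H (Y₁ ∪ Y₂) (⁅ e ⁆ ∪ (image (punchIn e) K₁ ∪ image (punchIn e) K₂))
        join {Y₁} {K₁} {Y₂} {K₂} (sub₁ , _ , conn₁) (sub₂ , _ , conn₂) x∈Y₁ y∈Y₂ =
          sub′ , (e₁ e , x∈p∪q⁺ (inj₁ x∈Y₁)) , connected-to H (e₁ e) to
          where
          K = ⁅ e ⁆ ∪ (image (punchIn e) K₁ ∪ image (punchIn e) K₂)
          sub′ : IsSubgraph H (Y₁ ∪ Y₂) K
          sub′ h h∈ with x∈p∪q⁻ ⁅ e ⁆ _ h∈
          ... | inj₁ h∈e rewrite x∈⁅y⁆⇒x≡y e h∈e = x∈p∪q⁺ (inj₁ x∈Y₁) , x∈p∪q⁺ (inj₂ y∈Y₂)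
          ... | inj₂ h∈′ with x∈p∪q⁻ (image (punchIn e) K₁) _ h∈′
          ... | inj₁ h∈₁ with ∈-image⁻ (punchIn e) K₁ h∈₁
          ... | d , d∈ , refl =
            x∈p∪q⁺ (inj₁ (proj₁ (sub₁ d d∈))) , x∈p∪q⁺ (inj₁ (proj₂ (sub₁ d d∈)))
          sub′ h h∈ | inj₂ h∈′ | inj₂ h∈₂ with ∈-image⁻ (punchIn e) K₂ h∈₂
          ... | d , d∈ , refl =
            x∈p∪q⁺ (inj₂ (proj₁ (sub₂ d d∈))) , x∈p∪q⁺ (inj₂ (proj₂ (sub₂ d d∈)))
          lift₁ : ∀ {u w} → Star (Adjacent D K₁) u w → Star (Adjacent H K) u w
          lift₁ = Star.map λ (d , d∈ , j) →
            punchIn e d , x∈p∪q⁺ (inj₂ (x∈p∪q⁺ (inj₁ (∈-image⁺ (punchIn e) d∈)))) , j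
          lift₂ : ∀ {u w} → Star (Adjacent D K₂) u w → Star (Adjacent H K) u w
          lift₂ = Star.map λ (d , d∈ , j) →
            punchIn e d , x∈p∪q⁺ {p = ⁅ e ⁆} (inj₂ (x∈p∪q⁺ {p = image (punchIn e) K₁} (inj₂ (∈-image⁺ (punchIn e) d∈)))) , j
          to : ∀ {u} → u ∈ Y₁ ∪ Y₂ → Star (Adjacent H K) u (e₁ e)
          to u∈ with x∈p∪q⁻ Y₁ Y₂ u∈
          ... | inj₁ u∈₁ = lift₁ (conn₁ _ _ u∈₁ x∈Y₁)
          ... | inj₂ u∈₂ = lift₂ (conn₂ _ _ u∈₂ y∈Y₂)
            ◅◅ (e , x∈p∪q⁺ (inj₁ (x∈⁅x⁆ e)) , inj₂ (refl , refl)) ◅ ε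

        F₁ F₂ : Subset (#E G)
        F₁ = componentEdges G X F x̂
        F₂ = componentEdges G X F ŷ

        -- Ensures that the lengths of the two components add up to at most that of `F`, no edge
        -- being counted twice.
        disjoint : ∀ {f} → f ∈ F₁ → ¬ f ∈ F₂
        disjoint f∈₁ f∈₂ = separated
          (walk-sym G (proj₂ (∈-component⁻ G X F x̂ (proj₂ (∈-componentEdges⁻ G X F x̂ f∈₁))))
           ◅◅ proj₂ (∈-component⁻ G X F ŷ (proj₂ (∈-componentEdges⁻ G X F ŷ f∈₂))))

        F₁∪F₂⊆F : F₁ ∪ F₂ ⊆ F
        F₁∪F₂⊆F f∈ with x∈p∪q⁻ F₁ F₂ f∈
        ... | inj₁ f∈₁ = proj₁ (∈-componentEdges⁻ G X F x̂ f∈₁)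
        ... | inj₂ f∈₂ = proj₁ (∈-componentEdges⁻ G X F ŷ f∈₂)

        estimate : ∀ K₁ K₂ m → (∀ f → 0ℚ ℚ.≤ lengthAt ℓ⁺ m f) →
          sumOver (wᴰ m) K₁ ℚ.≤ sumOver (lengthAt ℓ m) F₁ ℚ.+ ½ ℚ.* δ →
          sumOver (wᴰ m) K₂ ℚ.≤ sumOver (lengthAt ℓ m) F₂ ℚ.+ ½ ℚ.* δ →
          sumOver (wᴴ m) (⁅ e ⁆ ∪ (image (punchIn e) K₁ ∪ image (punchIn e) K₂))
            ℚ.≤ sumOver (lengthAt ℓ⁺ m) (inside ∷ F) ℚ.+ δ
        estimate K₁ K₂ m w≥0 h₁ h₂ = begin
          sumOver (wᴴ m) (⁅ e ⁆ ∪ (J₁ ∪ J₂))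
            ≤⟨ sumOver-∪ (w≥0 ∘ emap⁺) ⁅ e ⁆ (J₁ ∪ J₂) ⟩
          sumOver (wᴴ m) ⁅ e ⁆ ℚ.+ sumOver (wᴴ m) (J₁ ∪ J₂)
            ≤⟨ ℚₚ.+-mono-≤ (ℚₚ.≤-reflexive (trans (sumOver-⁅⁆ (wᴴ m) e) (wᴴ-e m)))
                 (ℚₚ.≤-trans (sumOver-∪ (w≥0 ∘ emap⁺) J₁ J₂)
                   (ℚₚ.+-mono-≤ (ℚₚ.≤-trans (image≤ K₁) h₁) (ℚₚ.≤-trans (image≤ K₂) h₂))) ⟩
          L ℚ.+ ((s₁ ℚ.+ ½ ℚ.* δ) ℚ.+ (s₂ ℚ.+ ½ ℚ.* δ))
            ≡⟨ solve 4 (λ L a b c → L :+ ((a :+ c) :+ (b :+ c)) := (L :+ (a :+ b)) :+ (c :+ c)) refl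
                 L s₁ s₂ (½ ℚ.* δ) ⟩
          (L ℚ.+ (s₁ ℚ.+ s₂)) ℚ.+ (½ ℚ.* δ ℚ.+ ½ ℚ.* δ)
            ≡⟨ cong₂ ℚ._+_ (cong (L ℚ.+_) (sumOver-disjoint-∪ (lengthAt ℓ m) F₁ F₂ disjoint)) (half+half δ) ⟩
          (L ℚ.+ sumOver (lengthAt ℓ m) (F₁ ∪ F₂)) ℚ.+ δ
            ≤⟨ ℚₚ.+-monoˡ-≤ δ (ℚₚ.+-monoʳ-≤ L
                 (sumOver-mono (w≥0 ∘ suc) F₁∪F₂⊆F (λ _ _ → ℚₚ.≤-refl))) ⟩
          sumOver (lengthAt ℓ⁺ m) (inside ∷ F) ℚ.+ δ ∎
          where
          open ℚₚ.≤-Reasoning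
          J₁ = image (punchIn e) K₁
          J₂ = image (punchIn e) K₂
          L  = lengthAt ℓ⁺ m zero
          s₁ = sumOver (lengthAt ℓ m) F₁
          s₂ = sumOver (lengthAt ℓ m) F₂
          image≤ : ∀ K → sumOver (wᴴ m) (image (punchIn e) K) ℚ.≤ sumOver (wᴰ m) K
          image≤ = sumOver-image {w = wᴴ m} (λ d → w≥0 (suc (emap ι d))) (punchIn e) (wᴴ-punchIn m)

        result : Goal (inside ∷ F) δ
        result with nonempty? (side x̂) | nonempty? (side ŷ)
        ... | _ | no empty = one-sided x̂∈X λ a∈A →
          [ id , (λ a∈ → ⊥-elim (empty (_ , a∈))) ]′ (sides a∈A)
        ... | no empty | yes _ = one-sided ŷ∈X λ a∈A →
          [ (λ a∈ → ⊥-elim (empty (_ , a∈))) , id ]′ (sides a∈A)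
        ... | yes (a₁ , a₁∈) | yes (a₂ , a₂∈) =
          let a₁∈A , s₁ = ∈-side⁻ x̂ a₁∈
              a₂∈A , s₂ = ∈-side⁻ ŷ a₂∈
              Y₁ , K₁ , c₁ , B₁⊆Y₁ , h₁ = half-approximation (e₁ e) x̂∈X (ℕₚ.≤-trans
                (∣⁅x⁆∪p∣≤∣q∣ (e₁ e) (λ a∈ → proj₁ (∈-side⁻ x̂ a∈)) (a₂ , a₂∈A ,
                  λ a₂∈x → separated (walk-sym G (proj₂ (∈-side⁻ x̂ a₂∈x)) ◅◅ s₂))) ∣A∣≤k)
              Y₂ , K₂ , c₂ , B₂⊆Y₂ , h₂ = half-approximation (e₂ e) ŷ∈X (ℕₚ.≤-trans
                (∣⁅x⁆∪p∣≤∣q∣ (e₂ e) (λ a∈ → proj₁ (∈-side⁻ ŷ a∈)) (a₁ , a₁∈A ,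
                  λ a₁∈y → separated (walk-sym G s₁ ◅◅ proj₂ (∈-side⁻ ŷ a₁∈y)))) ∣A∣≤k)
          in Y₁ ∪ Y₂ , _ ,
             join c₁ c₂ (B₁⊆Y₁ (x∈p∪q⁺ (inj₁ (x∈⁅x⁆ (e₁ e))))) (B₂⊆Y₂ (x∈p∪q⁺ (inj₁ (x∈⁅x⁆ (e₂ e))))) ,
             (λ a∈A → [ (λ a∈ → x∈p∪q⁺ (inj₁ (B₁⊆Y₁ (x∈p∪q⁺ {p = ⁅ e₁ e ⁆} (inj₂ a∈)))))
                      , (λ a∈ → x∈p∪q⁺ {p = Y₁} (inj₂ (B₂⊆Y₂ (x∈p∪q⁺ {p = ⁅ e₂ e ⁆} (inj₂ a∈))))) ]′ (sides a∈A)) ,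
             eventually-zip (λ m w≥0 (p , q) → estimate K₁ K₂ m w≥0 p q) (lengthAt-nonneg ℓ⁺)
               (eventually-zip (λ _ → _,_) h₁ h₂)

      approximable : Approximable ι⁺ ℓ⁺ A
      approximable {X} {outside ∷ F} (sub , ne , conn) A⊆X = transfer
        ((λ f f∈F → sub (suc f) (there f∈F)) , ne , λ u w u∈ w∈ → drop-walk (conn u w u∈ w∈))
        A⊆X outside id
      approximable {X} {inside ∷ F} (sub , ne , conn) A⊆X δ 0<δ with star? G F x̂ ŷ
      -- The ends of `e` are joined within `F`, so `e` is not a bridge and can be left out.
      ... | yes s = transfer
        ((λ f f∈F → sub (suc f) (there f∈F)) , ne , connected-to G x̂ to) A⊆X inside id δ 0<δ
        where
        to : ∀ {u} → u ∈ X → Star (Adjacent G F) u x̂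
        to u∈ with reach (conn _ _ u∈ (proj₁ (sub zero here))) refl
        ... | inj₁ t = t
        ... | inj₂ t = t ◅◅ walk-sym G s
      ... | no separated = Separated.result (λ f f∈F → sub (suc f) (there f∈F))
        (proj₁ (sub zero here)) (proj₂ (sub zero here))
        (λ u∈ → reach (conn _ _ u∈ (proj₁ (sub zero here))) refl) separated A⊆X δ 0<δ

    -- The length of `e` exceeds that of all of `G` by 1, more than a slack of ½ can cover. One
    -- index at which all the estimates hold gives the contradiction.
    avoids : ∀ {K F δ} → δ ℚ.≤ ½ →
      Eventually (λ m → sumOver (wᴴ m) K ℚ.≤ sumOver (lengthAt ℓ m) F ℚ.+ δ) → ¬ e ∈ K
    avoids {K} {F} {δ} δ≤½ K≲F e∈K
      with N , h ← eventually-zip (λ _ → _,_) (lengthAt-nonneg ℓ⁺) K≲F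
      with w≥0 , K≤F ← h N ℕₚ.≤-refl = ℚₚ.<-irrefl refl (begin-strict
        T ℚ.+ ½             <⟨ ℚₚ.+-monoʳ-< T (from-yes (½ ℚₚ.<? 1ℚ)) ⟩
        T ℚ.+ 1ℚ            ≡⟨ cong (ℚ._+ 1ℚ) (seq-totalLength ℓ ⊤ N) ⟨
        lengthAt ℓ⁺ N zero  ≡⟨ wᴴ-e N ⟨
        wᴴ N e              ≤⟨ sumOver-member (w≥0 ∘ emap⁺) e∈K ⟩
        sumOver (wᴴ N) K    ≤⟨ K≤F ⟩
        sumOver (lengthAt ℓ N) F ℚ.+ δ
          ≤⟨ ℚₚ.+-mono-≤ (sumOver-mono (w≥0 ∘ suc) {F} (λ _ → ∈⊤) (λ _ _ → ℚₚ.≤-refl)) δ≤½ ⟩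
        T ℚ.+ ½             ∎)
      where
      open ℚₚ.≤-Reasoning
      T = sumOver (lengthAt ℓ N) ⊤

  ℋ′-delete : ∀ {k} → ℋ′ k H → ℋ′ k D
  ℋ′-delete {k} H∈ℋ G ι ℓ approx A {X} {F} (sub , ne , conn) A⊆X δ 0<δ
    with H∈ℋ G⁺ ι⁺ ℓ⁺ (λ B B≤k → Approximation.approximable approx B≤k) A {X} {outside ∷ F}
           ((λ { (suc f) (there f∈F) → sub f f∈F }) , ne ,
            λ u w u∈ w∈ → Star.map (λ (f , f∈F , j) → suc f , there f∈F , j) (conn u w u∈ w∈))
           -- The slack must be at most δ for the claim and at most ½ for `avoids`.
           A⊆X (δ ℚ.⊓ ½) (⊓-positive 0<δ (ℚₚ.positive⁻¹ ½))
    where open Extension ι ℓ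
  ... | Y , K , c , A⊆Y , K≲F = preimage id Y , preimage (punchIn e) K ,
    pullback-connected D↪H c covered (proj₁ (proj₂ c)) , (λ a∈A → ∈-preimage⁺ id (A⊆Y a∈A)) ,
    eventually-zip (λ m w≥0 K≤F → ℚₚ.≤-trans
        (sumOver-preimage {w = wᴴ m} (w≥0 ∘ emap⁺) (punchIn e) (punchIn-injective e _ _) (λ d → sym (wᴴ-punchIn m d)) K)
        (ℚₚ.≤-trans K≤F (ℚₚ.+-monoʳ-≤ (sumOver (lengthAt ℓ m) F) (ℚₚ.p⊓q≤p δ ½))))
      (lengthAt-nonneg ℓ⁺) K≲F
    where
    open Extension ι ℓ
    covered : ∀ h → h ∈ K → ∃ λ d → punchIn e d ≡ h
    covered h h∈K with punchIn-cover e h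
    ... | inj₁ refl = ⊥-elim (avoids {K} {F} (ℚₚ.p⊓q≤q δ ½) K≲F h∈K)
    ... | inj₂ d    = d

-- Contracting the branch sets

split-cover : ∀ m {n} (i : Fin (m ℕ.+ n)) → (∃ λ j → j ↑ˡ n ≡ i) ⊎ (∃ λ j → m ↑ʳ j ≡ i)
split-cover m {n} i with splitAt m i | join-splitAt m n i
... | inj₁ j | eq = inj₁ (j , eq)
... | inj₂ j | eq = inj₂ (j , eq)

↑ˡ≢↑ʳ : ∀ {m n} (i : Fin m) (j : Fin n) → i ↑ˡ n ≢ m ↑ʳ j
↑ˡ≢↑ʳ {m} {n} i j eq with trans (sym (splitAt-↑ˡ m i n)) (trans (cong (splitAt m) eq) (splitAt-↑ʳ m n j))
... | ()

joins-embed : ∀ {H G} (ι : H ↪ G) {e u v} → Joins H e u v → Joins G (emap ι e) (vmap ι u) (vmap ι v)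
joins-embed ι     (inj₁ (refl , refl)) = incidence ι _
joins-embed {G = G} ι (inj₂ (refl , refl)) = joins-sym G (incidence ι _)

-- By `full`, collapsing the branch sets turns each edge of `H` into an edge of `G` or makes it
-- vanish. The vertex `x₀` is a default value.
module Contraction {H G : Graph} (μ : G IsMinorOf H)
  (full : ∀ g → (∃ λ e → _IsMinorOf_.edge μ e ≡ g)
                ⊎ ∃ λ x → g ∈ inducedEdges H (_IsMinorOf_.branch μ x))
  (x₀ : V G) where

  open _IsMinorOf_ μ

  Covered : V H → Set
  Covered u = ∃ λ x → u ∈ branch x

  covered? : Decidable Covered
  covered? u = any? (λ x → u ∈? branch x)

  root : V G → V H
  root x = proj₁ (proj₁ (connected x))

  root∈ : ∀ x → root x ∈ branch x
  root∈ x = proj₂ (proj₁ (connected x))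

  -- Vertices outside all branch sets are isolated, so their image does not matter.
  collapse : V H → V G
  collapse u with covered? u
  ... | yes (x , _) = x
  ... | no _        = x₀

  collapse-branch : ∀ {u x} → u ∈ branch x → collapse u ≡ x
  collapse-branch {u} {x} u∈ with covered? u
  ... | yes (y , u∈y) = disjoint u∈y u∈
  ... | no ¬c         = ⊥-elim (¬c (x , u∈))

  collapse-edge : ∀ e → Joins G e (collapse (end₁ H (edge e))) (collapse (end₂ H (edge e)))
  collapse-edge e with edge-joins e
  ... | u , v , u∈ , v∈ , inj₁ (refl , refl) =
    inj₁ (sym (collapse-branch u∈) , sym (collapse-branch v∈))
  ... | u , v , u∈ , v∈ , inj₂ (refl , refl) =
    inj₂ (sym (collapse-branch u∈) , sym (collapse-branch v∈))

  collapse-internal : ∀ {g x} → g ∈ inducedEdges H (branch x) →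
    collapse (end₁ H g) ≡ collapse (end₂ H g)
  collapse-internal {x = x} g∈ with ∈-inducedEdges⁻ H (branch x) g∈
  ... | p , q = trans (collapse-branch p) (sym (collapse-branch q))

  -- Otherwise `e` would be a loop of `G`. Consequently all inner edges of branch sets receive the
  -- length η.
  edge-not-internal : ∀ {e x} → ¬ edge e ∈ inducedEdges H (branch x)
  edge-not-internal {e} g∈ with collapse-edge e | collapse-internal g∈
  ... | inj₁ (p , q) | eq = loopless G e (trans p (trans eq (sym q)))
  ... | inj₂ (p , q) | eq = loopless G e (trans p (trans (sym eq) (sym q)))

  ends-covered : ∀ g → Covered (end₁ H g) × Covered (end₂ H g)
  ends-covered g with full g
  ... | inj₂ (x , g∈) with ∈-inducedEdges⁻ H (branch x) g∈
  ... | p , q = (x , p) , (x , q)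
  ends-covered g | inj₁ (e , refl) with edge-joins e
  ... | u , v , u∈ , v∈ , inj₁ (refl , refl) = (_ , u∈) , (_ , v∈)
  ... | u , v , u∈ , v∈ , inj₂ (refl , refl) = (_ , v∈) , (_ , u∈)

  blowup : Subset (#V G) → Subset (#V H)
  blowup Y = comprehension (λ u → any? (λ x → (x ∈? Y) ×-dec (u ∈? branch x)))

  ∈-blowup⁺ : ∀ {Y u x} → x ∈ Y → u ∈ branch x → u ∈ blowup Y
  ∈-blowup⁺ {Y} x∈ u∈ =
    ∈-comprehension⁺ (λ u → any? (λ x → (x ∈? Y) ×-dec (u ∈? branch x))) (_ , x∈ , u∈)

  ∈-blowup⁻ : ∀ Y {u} → u ∈ blowup Y → ∃ λ x → x ∈ Y × u ∈ branch x
  ∈-blowup⁻ Y = ∈-comprehension⁻ (λ u → any? (λ x → (x ∈? Y) ×-dec (u ∈? branch x)))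

  -- All inner edges are taken instead of spanning trees: η is so small that even all edges of `H`
  -- at length η cost at most P together.
  internal : Subset (#V G) → Subset (#E H)
  internal Y = comprehension (λ g → any? (λ x → (x ∈? Y) ×-dec (g ∈? inducedEdges H (branch x))))

  ∈-internal⁺ : ∀ {Y g x} → x ∈ Y → g ∈ inducedEdges H (branch x) → g ∈ internal Y
  ∈-internal⁺ {Y} x∈ g∈ = ∈-comprehension⁺
    (λ g → any? (λ x → (x ∈? Y) ×-dec (g ∈? inducedEdges H (branch x)))) (_ , x∈ , g∈)

  ∈-internal⁻ : ∀ Y {g} → g ∈ internal Y → ∃ λ x → x ∈ Y × g ∈ inducedEdges H (branch x)
  ∈-internal⁻ Y = ∈-comprehension⁻
    (λ g → any? (λ x → (x ∈? Y) ×-dec (g ∈? inducedEdges H (branch x))))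

  internal-ends : ∀ Y {g} → g ∈ internal Y → end₁ H g ∈ blowup Y × end₂ H g ∈ blowup Y
  internal-ends Y g∈ with ∈-internal⁻ Y g∈
  ... | x , x∈ , g∈x with ∈-inducedEdges⁻ H (branch x) g∈x
  ... | p , q = ∈-blowup⁺ x∈ p , ∈-blowup⁺ x∈ q

  walk-to-root : ∀ {Y x u} → x ∈ Y → u ∈ branch x → Star (Adjacent H (internal Y)) u (root x)
  walk-to-root {x = x} x∈Y u∈ = walk-⊆ H (∈-internal⁺ x∈Y) (proj₂ (connected x) _ _ u∈ (root∈ x))

  blowup-subgraph : ∀ {Y N} → ConnectedSubgraph G Y N →
    ConnectedSubgraph H (blowup Y) (image edge N ∪ internal Y)
  blowup-subgraph {Y} {N} (sub , conn) =
    sub′ , blowup-connected {H} {G} root conn (λ {y} y∈ → ∈-blowup⁺ y∈ (root∈ y)) to step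
    where
    K = image edge N ∪ internal Y
    sub′ : IsSubgraph H (blowup Y) K
    sub′ g g∈ with x∈p∪q⁻ (image edge N) (internal Y) g∈
    ... | inj₂ g∈I = internal-ends Y g∈I
    ... | inj₁ g∈N with ∈-image⁻ edge N g∈N
    ... | e , e∈N , refl with edge-joins e
    ... | u , v , u∈ , v∈ , j =
      joins-∈ H j (∈-blowup⁺ (proj₁ (sub e e∈N)) u∈) (∈-blowup⁺ (proj₂ (sub e e∈N)) v∈)
    I⊆K : internal Y ⊆ K
    I⊆K = q⊆p∪q (image edge N) (internal Y)
    to : ∀ {u} → u ∈ blowup Y → ∃ λ y → y ∈ Y × Star (Adjacent H K) u (root y)
    to u∈ with ∈-blowup⁻ Y u∈
    ... | x , x∈Y , u∈x = x , x∈Y , walk-⊆ H I⊆K (walk-to-root x∈Y u∈x)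
    across : ∀ e → e ∈ N → Star (Adjacent H K) (root (end₁ G e)) (root (end₂ G e))
    across e e∈N with edge-joins e
    ... | u , v , u∈ , v∈ , j =
      walk-sym H (walk-⊆ H I⊆K (walk-to-root (proj₁ (sub e e∈N)) u∈))
      ◅◅ (edge e , x∈p∪q⁺ (inj₁ (∈-image⁺ edge e∈N)) , j)
      ◅ walk-⊆ H I⊆K (walk-to-root (proj₂ (sub e e∈N)) v∈)
    step : ∀ {y z} → Adjacent G N y z → Star (Adjacent H K) (root y) (root z)
    step (e , e∈N , inj₁ (refl , refl)) = across e e∈N
    step (e , e∈N , inj₂ (refl , refl)) = walk-sym H (across e e∈N)

  collapse-subgraph : ∀ {Y K} → ConnectedSubgraph H Y K →
    ConnectedSubgraph G (image collapse Y) (preimage edge K)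
  collapse-subgraph {Y} {K} c = quotient-connected {H} {G} collapse c down
    (λ e e∈ → edge e , ∈-preimage⁻ edge K e∈ , collapse-edge e)
    where
    down : ∀ g → g ∈ K → collapse (end₁ H g) ≡ collapse (end₂ H g) ⊎
      ∃ λ e → e ∈ preimage edge K × Joins G e (collapse (end₁ H g)) (collapse (end₂ H g))
    down g g∈K with full g
    ... | inj₁ (e , refl) = inj₂ (e , ∈-preimage⁺ edge g∈K , collapse-edge e)
    ... | inj₂ (x , g∈)   = inj₁ (collapse-internal g∈)

  -- The graph glued from `H` and `G′`, and its projection onto `G′`

  module Gluing {G′ : Graph} (ι : G ↪ G′) (ℓ : LengthFunction G′)
    {η P : ℚ} (0<η : 0ℚ ℚ.< η) (0<P : 0ℚ ℚ.< P) (Ση≤P : sumOver {#E H} (λ _ → η) ⊤ ℚ.≤ P) where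

    inlᵛ : V H → Fin (#V H ℕ.+ #V G′)
    inlᵛ u = u ↑ˡ #V G′

    inlᵉ : E H → Fin (#E H ℕ.+ #E G′)
    inlᵉ g = g ↑ˡ #E G′

    inrᵉ : E G′ → Fin (#E H ℕ.+ #E G′)
    inrᵉ f = #E H ↑ʳ f

    -- The vertex set of the glued graph is the full disjoint union, with no quotient taken: the
    -- right-hand copies of vertices of `G` stay behind as isolated vertices.
    rep : V G′ → Fin (#V H ℕ.+ #V G′)
    rep v with any? (λ x → vmap ι x ≟ v)
    ... | yes (x , _) = inlᵛ (root x)
    ... | no _        = #V H ↑ʳ v

    rep-ι : ∀ x → rep (vmap ι x) ≡ inlᵛ (root x)
    rep-ι x with any? (λ y → vmap ι y ≟ vmap ι x)
    ... | yes (y , eq) = cong (inlᵛ ∘ root) (vmap-injective ι eq)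
    ... | no ¬c        = ⊥-elim (¬c (x , refl))

    rep-covered : ∀ {v u} → rep v ≡ inlᵛ u → Covered u
    rep-covered {v} eq with any? (λ x → vmap ι x ≟ v)
    ... | yes (x , _) = x , subst (_∈ branch x) (↑ˡ-injective _ _ _ eq) (root∈ x)
    ... | no _        = ⊥-elim (↑ˡ≢↑ʳ _ _ (sym eq))

    -- Retracts the glued graph onto `G′` by contracting the branch sets.
    π : Fin (#V H ℕ.+ #V G′) → V G′
    π w = [ vmap ι ∘ collapse , id ]′ (splitAt (#V H) w)

    π-inl : ∀ u → π (inlᵛ u) ≡ vmap ι (collapse u)
    π-inl u = cong [ vmap ι ∘ collapse , id ]′ (splitAt-↑ˡ (#V H) u (#V G′))

    π-rep : ∀ v → π (rep v) ≡ v
    π-rep v with any? (λ x → vmap ι x ≟ v)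
    ... | yes (x , refl) = trans (π-inl (root x)) (cong (vmap ι) (collapse-branch (root∈ x)))
    ... | no _           = cong [ vmap ι ∘ collapse , id ]′ (splitAt-↑ʳ (#V H) (#V G′) v)

    rep-injective : ∀ {v w} → rep v ≡ rep w → v ≡ w
    rep-injective eq = trans (sym (π-rep _)) (trans (cong π eq) (π-rep _))

    end₁′ end₂′ : Fin (#E H ℕ.+ #E G′) → Fin (#V H ℕ.+ #V G′)
    end₁′ i = [ inlᵛ ∘ end₁ H , rep ∘ end₁ G′ ]′ (splitAt (#E H) i)
    end₂′ i = [ inlᵛ ∘ end₂ H , rep ∘ end₂ G′ ]′ (splitAt (#E H) i)

    loopless′ : ∀ i → end₁′ i ≢ end₂′ i
    loopless′ i with splitAt (#E H) i
    ... | inj₁ g = loopless H g ∘ ↑ˡ-injective _ _ _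
    ... | inj₂ f = loopless G′ f ∘ rep-injective

    H′ : Graph
    H′ = record { #V = #V H ℕ.+ #V G′ ; #E = #E H ℕ.+ #E G′
                ; end₁ = end₁′ ; end₂ = end₂′ ; loopless = loopless′ }

    end₁-inl : ∀ g → end₁′ (inlᵉ g) ≡ inlᵛ (end₁ H g)
    end₁-inl g = cong [ inlᵛ ∘ end₁ H , rep ∘ end₁ G′ ]′ (splitAt-↑ˡ (#E H) g (#E G′))

    end₂-inl : ∀ g → end₂′ (inlᵉ g) ≡ inlᵛ (end₂ H g)
    end₂-inl g = cong [ inlᵛ ∘ end₂ H , rep ∘ end₂ G′ ]′ (splitAt-↑ˡ (#E H) g (#E G′))

    end₁-inr : ∀ f → end₁′ (inrᵉ f) ≡ rep (end₁ G′ f)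
    end₁-inr f = cong [ inlᵛ ∘ end₁ H , rep ∘ end₁ G′ ]′ (splitAt-↑ʳ (#E H) (#E G′) f)

    end₂-inr : ∀ f → end₂′ (inrᵉ f) ≡ rep (end₂ G′ f)
    end₂-inr f = cong [ inlᵛ ∘ end₂ H , rep ∘ end₂ G′ ]′ (splitAt-↑ʳ (#E H) (#E G′) f)

    H↪H′ : H ↪ H′
    H↪H′ = record
      { vmap = inlᵛ ; emap = inlᵉ
      ; vmap-injective = ↑ˡ-injective _ _ _ ; emap-injective = ↑ˡ-injective _ _ _
      ; incidence = λ g → inj₁ (end₁-inl g , end₂-inl g) }

    lengthᴴ : E H → ℝ
    lengthᴴ g with any? (λ e → edge e ≟ g)
    ... | yes (e , _) = length ℓ (emap ι e)
    ... | no _        = constant η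

    lengthᴴ-positive : ∀ g → 0ℝ < lengthᴴ g
    lengthᴴ-positive g with any? (λ e → edge e ≟ g)
    ... | yes (e , _) = positive ℓ (emap ι e)
    ... | no _        = constant-positive 0<η

    lengthᴴ-edge : ∀ e → lengthᴴ (edge e) ≡ length ℓ (emap ι e)
    lengthᴴ-edge e with any? (λ e′ → edge e′ ≟ edge e)
    ... | yes (e′ , eq) = cong (length ℓ ∘ emap ι) (edge-injective eq)
    ... | no ¬c         = ⊥-elim (¬c (e , refl))

    lengthᴴ-internal : ∀ {Y g} → g ∈ internal Y → lengthᴴ g ≡ constant η
    lengthᴴ-internal {Y} {g} g∈ with any? (λ e → edge e ≟ g)
    ... | no _           = refl
    ... | yes (e , refl) = ⊥-elim (edge-not-internal (proj₂ (proj₂ (∈-internal⁻ Y g∈))))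

    length⁺ : E G′ → ℝ
    length⁺ f = length ℓ f + constant P

    length⁺-positive : ∀ f → 0ℝ < length⁺ f
    length⁺-positive f = +constant-positive {length ℓ f}
      (eventually-map (λ n w≥0 → w≥0 f) (lengthAt-nonneg ℓ)) 0<P

    length′ : E H′ → ℝ
    length′ i = [ lengthᴴ , length⁺ ]′ (splitAt (#E H) i)

    positive′ : ∀ i → 0ℝ < length′ i
    positive′ i with splitAt (#E H) i
    ... | inj₁ g = lengthᴴ-positive g
    ... | inj₂ f = length⁺-positive f

    ℓ′ : LengthFunction H′
    ℓ′ = record { length = length′ ; positive = positive′ }

    wᴴ : ℕ → E H → ℚ
    wᴴ = lengthAt (restrict H↪H′ ℓ′)

    wᴴ≡ : ∀ m g → wᴴ m g ≡ seq (lengthᴴ g) m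
    wᴴ≡ m g = cong (λ s → seq ([ lengthᴴ , length⁺ ]′ s) m) (splitAt-↑ˡ (#E H) g (#E G′))

    wᴴ-edge : ∀ m e → wᴴ m (edge e) ≡ lengthAt (restrict ι ℓ) m e
    wᴴ-edge m e = trans (wᴴ≡ m (edge e)) (cong (λ x → seq x m) (lengthᴴ-edge e))

    w′-inr : ∀ m f → lengthAt ℓ′ m (inrᵉ f) ≡ lengthAt ℓ m f ℚ.+ P
    w′-inr m f = cong (λ s → seq ([ lengthᴴ , length⁺ ]′ s) m) (splitAt-↑ʳ (#E H) (#E G′) f)

    internal-sum : ∀ m Y → sumOver (wᴴ m) (internal Y) ℚ.≤ P
    internal-sum m Y = ℚₚ.≤-trans
      (sumOver-mono (λ _ → ℚₚ.<⇒≤ 0<η) (λ _ → ∈⊤) λ g g∈ →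
        ℚₚ.≤-reflexive (trans (wᴴ≡ m g) (cong (λ x → seq x m) (lengthᴴ-internal {Y} g∈))))
      Ση≤P

    joined-covered : ∀ i {u w} → Joins H′ i (inlᵛ u) w → Covered u
    joined-covered i j with split-cover (#E H) i
    joined-covered i (inj₁ (p , _)) | inj₁ (g , refl) = subst Covered
      (↑ˡ-injective _ _ _ (trans (sym (end₁-inl g)) p)) (proj₁ (ends-covered g))
    joined-covered i (inj₂ (_ , p)) | inj₁ (g , refl) = subst Covered
      (↑ˡ-injective _ _ _ (trans (sym (end₂-inl g)) p)) (proj₂ (ends-covered g))
    joined-covered i (inj₁ (p , _)) | inj₂ (f , refl) = rep-covered (trans (sym (end₁-inr f)) p)
    joined-covered i (inj₂ (_ , p)) | inj₂ (f , refl) = rep-covered (trans (sym (end₂-inr f)) p)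

    -- A vertex of `H` outside all branch sets is isolated in `H′` and differs from every `rep v`.
    -- Hence terminals connected to an edge from `G′` are never sent to the default `x₀` by
    -- `collapse`.
    walk-covered : ∀ {F u v} → Star (Adjacent H′ F) (inlᵛ u) (rep v) → Covered u
    walk-covered s = go s refl
      where
      go : ∀ {F u v w} → Star (Adjacent H′ F) (inlᵛ u) w → w ≡ rep v → Covered u
      go ε                 eq = rep-covered (sym eq)
      go ((i , _ , j) ◅ _) _  = joined-covered i j

    nonneg : Eventually λ m →
      (∀ i → 0ℚ ℚ.≤ lengthAt ℓ′ m i) × (∀ f → 0ℚ ℚ.≤ lengthAt ℓ m f)
    nonneg = eventually-zip (λ _ → _,_) (lengthAt-nonneg ℓ′) (lengthAt-nonneg ℓ)

    module Projection (F : Subset (#E H′)) where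

      -- An edge of `G` has two copies in `H′`, one from `H` and one from `G′`. Either puts it into
      -- the projection, where it counts once.
      InProjection : E G′ → Set
      InProjection f = inrᵉ f ∈ F ⊎ ∃ λ e → emap ι e ≡ f × inlᵉ (edge e) ∈ F

      inProjection? : Decidable InProjection
      inProjection? f = (inrᵉ f ∈? F) ⊎-dec any? (λ e → (emap ι e ≟ f) ×-dec (inlᵉ (edge e) ∈? F))

      M : Subset (#E G′)
      M = comprehension inProjection?

      joins-inl : ∀ e → Joins G′ (emap ι e) (π (end₁′ (inlᵉ (edge e)))) (π (end₂′ (inlᵉ (edge e))))
      joins-inl e = subst₂ (Joins G′ (emap ι e))
        (sym (trans (cong π (end₁-inl (edge e))) (π-inl _)))
        (sym (trans (cong π (end₂-inl (edge e))) (π-inl _)))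
        (joins-embed ι (collapse-edge e))

      joins-inr : ∀ f → Joins G′ f (π (end₁′ (inrᵉ f))) (π (end₂′ (inrᵉ f)))
      joins-inr f = inj₁ (sym (trans (cong π (end₁-inr f)) (π-rep _)) ,
                          sym (trans (cong π (end₂-inr f)) (π-rep _)))

      projection : ∀ {X} → ConnectedSubgraph H′ X F → ConnectedSubgraph G′ (image π X) M
      projection c = quotient-connected {H′} {G′} π c down up
        where
        down : ∀ i → i ∈ F → π (end₁′ i) ≡ π (end₂′ i)
          ⊎ ∃ λ f → f ∈ M × Joins G′ f (π (end₁′ i)) (π (end₂′ i))
        down i i∈F with split-cover (#E H) i
        ... | inj₂ (f , refl) = inj₂ (f , ∈-comprehension⁺ inProjection? (inj₁ i∈F) , joins-inr f)
        ... | inj₁ (g , refl) with full g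
        ... | inj₁ (e , refl) = inj₂ (emap ι e ,
          ∈-comprehension⁺ inProjection? (inj₂ (e , refl , i∈F)) , joins-inl e)
        ... | inj₂ (x , g∈) = inj₁ (trans (trans (cong π (end₁-inl g)) (π-inl _)) (trans
          (cong (vmap ι) (collapse-internal g∈))
          (sym (trans (cong π (end₂-inl g)) (π-inl _)))))
        up : ∀ f → f ∈ M → ∃ λ i → i ∈ F × Joins G′ f (π (end₁′ i)) (π (end₂′ i))
        up f f∈M with ∈-comprehension⁻ inProjection? f∈M
        ... | inj₁ f∈F              = inrᵉ f , f∈F , joins-inr f
        ... | inj₂ (e , refl , e∈F) = inlᵉ (edge e) , e∈F , joins-inl e

      -- `R f i` means that `i` is a copy of `f`. An edge may have two copies, but a copy has one
      -- original, which is the injectivity that `sumOver-injection` requires.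
      R : E G′ → E H′ → Set
      R f i = inrᵉ f ≡ i ⊎ ∃ λ e → emap ι e ≡ f × inlᵉ (edge e) ≡ i

      R-injective : ∀ {f f′ i} → R f i → R f′ i → f ≡ f′
      R-injective (inj₁ refl) (inj₁ eq) = sym (↑ʳ-injective _ _ _ eq)
      R-injective (inj₁ refl) (inj₂ (_ , _ , eq)) = ⊥-elim (↑ˡ≢↑ʳ _ _ eq)
      R-injective (inj₂ (_ , _ , eq)) (inj₁ refl) = ⊥-elim (↑ˡ≢↑ʳ _ _ eq)
      R-injective (inj₂ (e , refl , refl)) (inj₂ (e′ , refl , eq)) =
        cong (emap ι) (sym (edge-injective (↑ˡ-injective _ _ _ eq)))

      -- Lengths in `H′` are split into the length before gluing and the surcharge P, so that the
      -- projection can be charged to the former alone.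
      base penalty : ℕ → E H′ → ℚ
      base m i    = [ (λ g → seq (lengthᴴ g) m) , lengthAt ℓ m ]′ (splitAt (#E H) i)
      penalty m i = [ (λ _ → 0ℚ) , (λ _ → P) ]′ (splitAt (#E H) i)

      base+penalty : ∀ m i → base m i ℚ.+ penalty m i ≡ lengthAt ℓ′ m i
      base+penalty m i with splitAt (#E H) i
      ... | inj₁ g = ℚₚ.+-identityʳ _
      ... | inj₂ f = refl

      base-nonneg : ∀ m → (∀ i → 0ℚ ℚ.≤ lengthAt ℓ′ m i) → (∀ f → 0ℚ ℚ.≤ lengthAt ℓ m f) →
        ∀ i → 0ℚ ℚ.≤ base m i
      base-nonneg m w′≥0 w≥0 i with splitAt (#E H) i | w′≥0 i
      ... | inj₁ g | p = p
      ... | inj₂ f | _ = w≥0 f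

      penalty-nonneg : ∀ m i → 0ℚ ℚ.≤ penalty m i
      penalty-nonneg m i with splitAt (#E H) i
      ... | inj₁ g = ℚₚ.≤-refl
      ... | inj₂ f = ℚₚ.<⇒≤ 0<P

      base-inr : ∀ m f → base m (inrᵉ f) ≡ lengthAt ℓ m f
      base-inr m f = cong [ (λ g → seq (lengthᴴ g) m) , lengthAt ℓ m ]′ (splitAt-↑ʳ (#E H) (#E G′) f)

      base-edge : ∀ m e → base m (inlᵉ (edge e)) ≡ lengthAt ℓ m (emap ι e)
      base-edge m e = trans
        (cong [ (λ g → seq (lengthᴴ g) m) , lengthAt ℓ m ]′ (splitAt-↑ˡ (#E H) (edge e) (#E G′)))
        (cong (λ x → seq x m) (lengthᴴ-edge e))

      -- The base lengths in `F` pay for `M`, and the surcharge of the single edge `f` is left over.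
      -- This one P is what `blowup-sum` spends.
      projection-sum : ∀ m → (∀ i → 0ℚ ℚ.≤ lengthAt ℓ′ m i) → (∀ f → 0ℚ ℚ.≤ lengthAt ℓ m f) →
        ∀ {f} → inrᵉ f ∈ F → sumOver (lengthAt ℓ m) M ℚ.+ P ℚ.≤ sumOver (lengthAt ℓ′ m) F
      projection-sum m w′≥0 w≥0 {f} f∈F = begin
        sumOver (lengthAt ℓ m) M ℚ.+ P
          ≤⟨ ℚₚ.+-mono-≤
               (sumOver-injection (base-nonneg m w′≥0 w≥0) R R-injective M F φ)
               (ℚₚ.≤-trans
                 (ℚₚ.≤-reflexive (sym (cong [ (λ _ → 0ℚ) , (λ _ → P) ]′ (splitAt-↑ʳ (#E H) (#E G′) f))))
                 (sumOver-member (penalty-nonneg m) f∈F)) ⟩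
        sumOver (base m) F ℚ.+ sumOver (penalty m) F
          ≡⟨ sumOver-+ (base m) (penalty m) F ⟨
        sumOver (λ i → base m i ℚ.+ penalty m i) F
          ≤⟨ sumOver-mono w′≥0 {F} id (λ i _ → ℚₚ.≤-reflexive (base+penalty m i)) ⟩
        sumOver (lengthAt ℓ′ m) F ∎
        where
        open ℚₚ.≤-Reasoning
        φ : ∀ f → f ∈ M → ∃ λ i → i ∈ F × R f i × lengthAt ℓ m f ℚ.≤ base m i
        φ f f∈M with ∈-comprehension⁻ inProjection? f∈M
        ... | inj₁ f∈F = inrᵉ f , f∈F , inj₁ refl , ℚₚ.≤-reflexive (sym (base-inr m f))
        ... | inj₂ (e , refl , e∈F) = inlᵉ (edge e) , e∈F , inj₂ (e , refl , refl) ,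
          ℚₚ.≤-reflexive (sym (base-edge m e))

    blowup-sum : ∀ m → (∀ i → 0ℚ ℚ.≤ lengthAt ℓ′ m i) → (∀ f → 0ℚ ℚ.≤ lengthAt ℓ m f) → ∀ N Y →
      sumOver (wᴴ m) (image edge N ∪ internal Y) ℚ.≤ sumOver (lengthAt (restrict ι ℓ) m) N ℚ.+ P
    blowup-sum m w′≥0 w≥0 N Y = ℚₚ.≤-trans
      (sumOver-∪ (w′≥0 ∘ inlᵉ) (image edge N) (internal Y))
      (ℚₚ.+-mono-≤ (sumOver-image {w = wᴴ m} (w≥0 ∘ emap ι) edge (wᴴ-edge m) N) (internal-sum m Y))

    module Approximation {k : ℕ} (approx : ∀ B → ∣ B ∣ ≤ k → Approximable ι ℓ B)
      {A : Subset (#V H)} (∣A∣≤k : ∣ A ∣ ≤ k)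
      {X : Subset (#V H′)} {F : Subset (#E H′)} (c : ConnectedSubgraph H′ X F)
      (A⊆X : ∀ {a} → a ∈ A → inlᵛ a ∈ X) (δ : ℚ) (0<δ : 0ℚ ℚ.< δ) where

      open Projection F

      Goal : Set
      Goal = ∃₂ λ Y K → ConnectedSubgraph H Y K × A ⊆ Y ×
        Eventually (λ m → sumOver (wᴴ m) K ℚ.≤ sumOver (lengthAt ℓ′ m) F ℚ.+ δ)

      -- Without terminals the given subgraph may miss `H` entirely, and its pullback would be null;
      -- a single vertex, of length zero, takes its place.
      on-empty : Empty A → Goal
      on-empty empty = ⁅ root x₀ ⁆ , ⊥ , single-vertex H (root x₀) ,
        (λ a∈A → ⊥-elim (empty (_ , a∈A))) ,
        eventually-map (λ m w′≥0 → ℚₚ.≤-trans (ℚₚ.≤-reflexive (sumOver-⊥ (wᴴ m)))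
            (ℚₚ.+-mono-≤ (sumOver-nonneg w′≥0 F) (ℚₚ.<⇒≤ 0<δ)))
          (lengthAt-nonneg ℓ′)

      inl-cover : ¬ (∃ λ f → inrᵉ f ∈ F) → ∀ i → i ∈ F → ∃ λ g → inlᵉ g ≡ i
      inl-cover inH i i∈F with split-cover (#E H) i
      ... | inj₁ g          = g
      ... | inj₂ (f , refl) = ⊥-elim (inH (f , i∈F))

      within-H-connected : Nonempty A → ¬ (∃ λ f → inrᵉ f ∈ F) →
        ConnectedSubgraph H (preimage inlᵛ X) (preimage inlᵉ F)
      within-H-connected (a₀ , a₀∈A) inH =
        pullback-connected H↪H′ c (inl-cover inH) (a₀ , A⊆X a₀∈A)

      within-H-sum : ∀ m → (∀ i → 0ℚ ℚ.≤ lengthAt ℓ′ m i) →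
        sumOver (wᴴ m) (preimage inlᵉ F) ℚ.≤ sumOver (lengthAt ℓ′ m) F ℚ.+ δ
      within-H-sum m w′≥0 = ℚₚ.≤-trans
        (sumOver-preimage {w = lengthAt ℓ′ m} {wᴴ m} w′≥0 inlᵉ (↑ˡ-injective _ _ _) (λ _ → refl) F)
        (x≤x+y (sumOver (lengthAt ℓ′ m) F) (ℚₚ.<⇒≤ 0<δ))

      within-H : Nonempty A → ¬ (∃ λ f → inrᵉ f ∈ F) → Goal
      within-H nonempty inH = preimage inlᵛ X , preimage inlᵉ F , within-H-connected nonempty inH ,
        (λ a∈A → ∈-preimage⁺ inlᵛ (A⊆X a∈A)) ,
        eventually-map within-H-sum (lengthAt-nonneg ℓ′)

      collapse-A⊆ : ∀ {b} → b ∈ image collapse A → vmap ι b ∈ image π X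
      collapse-A⊆ b∈ with ∈-image⁻ collapse A b∈
      ... | a , a∈A , refl = subst (_∈ image π X) (π-inl a) (∈-image⁺ π (A⊆X a∈A))

      A-covered : ∀ {f} → inrᵉ f ∈ F → ∀ {a} → a ∈ A → Covered a
      A-covered {f} f∈F a∈A = walk-covered (proj₂ (proj₂ c) _ _ (A⊆X a∈A)
        (subst (_∈ X) (end₁-inr f) (proj₁ (proj₁ c (inrᵉ f) f∈F))))

      estimate : ∀ {f} → inrᵉ f ∈ F → ∀ N Y m →
        (∀ i → 0ℚ ℚ.≤ lengthAt ℓ′ m i) × (∀ f → 0ℚ ℚ.≤ lengthAt ℓ m f) →
        sumOver (lengthAt (restrict ι ℓ) m) N ℚ.≤ sumOver (lengthAt ℓ m) M ℚ.+ δ →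
        sumOver (wᴴ m) (image edge N ∪ internal Y) ℚ.≤ sumOver (lengthAt ℓ′ m) F ℚ.+ δ
      estimate f∈F N Y m (w′≥0 , w≥0) N≤M = begin
        sumOver (wᴴ m) (image edge N ∪ internal Y)         ≤⟨ blowup-sum m w′≥0 w≥0 N Y ⟩
        sumOver (lengthAt (restrict ι ℓ) m) N ℚ.+ P         ≤⟨ ℚₚ.+-monoˡ-≤ P N≤M ⟩
        sumOver (lengthAt ℓ m) M ℚ.+ δ ℚ.+ P
          ≡⟨ solve 3 (λ a b c → a :+ b :+ c := a :+ c :+ b) refl (sumOver (lengthAt ℓ m) M) δ P ⟩
        sumOver (lengthAt ℓ m) M ℚ.+ P ℚ.+ δ
          ≤⟨ ℚₚ.+-monoˡ-≤ δ (projection-sum m w′≥0 w≥0 f∈F) ⟩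
        sumOver (lengthAt ℓ′ m) F ℚ.+ δ                    ∎
        where open ℚₚ.≤-Reasoning

      lift-approximation : ∀ {f} → inrᵉ f ∈ F →
        (∃₂ λ Y N → ConnectedSubgraph G Y N × image collapse A ⊆ Y × Eventually (λ m →
          sumOver (lengthAt (restrict ι ℓ) m) N ℚ.≤ sumOver (lengthAt ℓ m) M ℚ.+ δ)) → Goal
      lift-approximation f∈F (Y , N , c′ , B⊆Y , N≲M) =
        blowup Y , image edge N ∪ internal Y , blowup-subgraph c′ , A⊆blowup ,
        eventually-zip (estimate f∈F N Y) nonneg N≲M
        where
        A⊆blowup : A ⊆ blowup Y
        A⊆blowup a∈A with A-covered f∈F a∈A
        ... | x , a∈x =
          ∈-blowup⁺ (subst (_∈ Y) (collapse-branch a∈x) (B⊆Y (∈-image⁺ collapse a∈A))) a∈x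

      -- Collapsing does not increase the number of terminals, so the hypothesis on `G` applies to
      -- their images.
      outside-H : (∃ λ f → inrᵉ f ∈ F) → Goal
      outside-H (f , f∈F) = lift-approximation f∈F (approx (image collapse A)
        (ℕₚ.≤-trans (∣image∣≤ collapse A) ∣A∣≤k) (projection c) collapse-A⊆ δ 0<δ)

      cases : Dec (Nonempty A) → Dec (∃ λ f → inrᵉ f ∈ F) → Goal
      cases (no empty)     _         = on-empty empty
      cases (yes nonempty) (no inH)  = within-H nonempty inH
      cases (yes _)        (yes out) = outside-H out

      result : Goal
      result = cases (nonempty? A) (any? (λ f → inrᵉ f ∈? F))

    approximable : ∀ {k} → (∀ B → ∣ B ∣ ≤ k → Approximable ι ℓ B) →
      ∀ A → ∣ A ∣ ≤ k → Approximable H↪H′ ℓ′ A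
    approximable approx A ∣A∣≤k c A⊆X δ 0<δ = Approximation.result approx ∣A∣≤k c A⊆X δ 0<δ

    -- The way back, from `G′` to the glued graph. Every edge of `F`, even one that belongs to `G`,
    -- is lifted to its right-hand copy, which costs one surcharge per edge.
    module Lift {X : Subset (#V G′)} {F : Subset (#E G′)} (c : ConnectedSubgraph G′ X F) where

      Y : Subset (#V G)
      Y = preimage (vmap ι) X

      X′ : Subset (#V H′)
      X′ = image rep X ∪ image inlᵛ (blowup Y)

      F′ : Subset (#E H′)
      F′ = image inrᵉ F ∪ image inlᵉ (internal Y)

      lift-connected : ConnectedSubgraph H′ X′ F′
      lift-connected = sub′ , blowup-connected {H′} {G′} rep (proj₂ c)
        (λ y∈ → x∈p∪q⁺ (inj₁ (∈-image⁺ rep y∈))) to step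
        where
        inl∈ : ∀ {u} → u ∈ blowup Y → inlᵛ u ∈ X′
        inl∈ u∈ = x∈p∪q⁺ {p = image rep X} (inj₂ (∈-image⁺ inlᵛ u∈))
        sub′ : IsSubgraph H′ X′ F′
        sub′ i i∈ with x∈p∪q⁻ (image inrᵉ F) _ i∈
        ... | inj₁ i∈F with ∈-image⁻ inrᵉ F i∈F
        ... | f , f∈F , refl =
          subst (_∈ X′) (sym (end₁-inr f)) (x∈p∪q⁺ (inj₁ (∈-image⁺ rep (proj₁ (proj₁ c f f∈F))))) ,
          subst (_∈ X′) (sym (end₂-inr f)) (x∈p∪q⁺ (inj₁ (∈-image⁺ rep (proj₂ (proj₁ c f f∈F)))))
        sub′ i i∈ | inj₂ i∈I with ∈-image⁻ inlᵉ (internal Y) i∈I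
        ... | g , g∈I , refl =
          subst (_∈ X′) (sym (end₁-inl g)) (inl∈ (proj₁ (internal-ends Y g∈I))) ,
          subst (_∈ X′) (sym (end₂-inl g)) (inl∈ (proj₂ (internal-ends Y g∈I)))
        to : ∀ {w} → w ∈ X′ → ∃ λ v → v ∈ X × Star (Adjacent H′ F′) w (rep v)
        to w∈ with x∈p∪q⁻ (image rep X) _ w∈
        ... | inj₁ w∈X with ∈-image⁻ rep X w∈X
        ... | v , v∈X , refl = v , v∈X , ε
        to w∈ | inj₂ w∈B with ∈-image⁻ inlᵛ (blowup Y) w∈B
        ... | u , u∈B , refl with ∈-blowup⁻ Y u∈B
        ... | x , x∈Y , u∈x = vmap ι x , ∈-preimage⁻ (vmap ι) X x∈Y ,
          subst (Star _ _) (sym (rep-ι x)) (Star.gmap inlᵛ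
            (λ (g , g∈I , j) → inlᵉ g ,
              x∈p∪q⁺ {p = image inrᵉ F} (inj₂ (∈-image⁺ inlᵉ g∈I)) , joins-embed H↪H′ j)
            (walk-to-root x∈Y u∈x))
        step : ∀ {y z} → Adjacent G′ F y z → Star (Adjacent H′ F′) (rep y) (rep z)
        step (f , f∈F , inj₁ (refl , refl)) =
          (inrᵉ f , x∈p∪q⁺ (inj₁ (∈-image⁺ inrᵉ f∈F)) , inj₁ (end₁-inr f , end₂-inr f)) ◅ ε
        step (f , f∈F , inj₂ (refl , refl)) =
          (inrᵉ f , x∈p∪q⁺ (inj₁ (∈-image⁺ inrᵉ f∈F)) , inj₂ (end₁-inr f , end₂-inr f)) ◅ ε

      -- The excess consists of one P for the inner edges and at most one P for each edge of `G′`.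
      lift-sum : ∀ m → (∀ i → 0ℚ ℚ.≤ lengthAt ℓ′ m i) → (∀ f → 0ℚ ℚ.≤ lengthAt ℓ m f) →
        sumOver (lengthAt ℓ′ m) F′
          ℚ.≤ sumOver (lengthAt ℓ m) F ℚ.+ (P ℚ.+ sumOver {#E G′} (λ _ → P) ⊤)
      lift-sum m w′≥0 w≥0 = begin
        sumOver (lengthAt ℓ′ m) F′
          ≤⟨ sumOver-∪ w′≥0 (image inrᵉ F) (image inlᵉ (internal Y)) ⟩
        sumOver (lengthAt ℓ′ m) (image inrᵉ F) ℚ.+ sumOver (lengthAt ℓ′ m) (image inlᵉ (internal Y))
          ≤⟨ ℚₚ.+-mono-≤
               (sumOver-image {w = lengthAt ℓ′ m} (λ f → ℚₚ.+-mono-≤ (w≥0 f) (ℚₚ.<⇒≤ 0<P)) inrᵉ (w′-inr m) F)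
               (ℚₚ.≤-trans
                 (sumOver-image {w = lengthAt ℓ′ m} {wᴴ m} (w′≥0 ∘ inlᵉ) inlᵉ (λ _ → refl) (internal Y))
                 (internal-sum m Y)) ⟩
        sumOver (λ f → lengthAt ℓ m f ℚ.+ P) F ℚ.+ P
          ≡⟨ cong (ℚ._+ P) (sumOver-+ (lengthAt ℓ m) (λ _ → P) F) ⟩
        s ℚ.+ sumOver (λ _ → P) F ℚ.+ P
          ≤⟨ ℚₚ.+-monoˡ-≤ P (ℚₚ.+-monoʳ-≤ s
               (sumOver-mono (λ _ → ℚₚ.<⇒≤ 0<P) {F} (λ _ → ∈⊤) (λ _ _ → ℚₚ.≤-refl))) ⟩
        s ℚ.+ t ℚ.+ P
          ≡⟨ solve 3 (λ a b c → a :+ b :+ c := a :+ (c :+ b)) refl s t P ⟩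
        s ℚ.+ (P ℚ.+ t) ∎
        where
        open ℚₚ.≤-Reasoning
        s = sumOver (lengthAt ℓ m) F
        t = sumOver {#E G′} (λ _ → P) ⊤

-- Terminals of `G` are represented in `H` by their roots, and collapsing the solution found in `H`
-- recovers them. Half of δ goes to that solution, the other half to the excess in `lift-sum`.
ℋ′-contract : ∀ {k H G} (μ : G IsMinorOf H) →
  (∀ g → (∃ λ e → _IsMinorOf_.edge μ e ≡ g)
         ⊎ ∃ λ x → g ∈ inducedEdges H (_IsMinorOf_.branch μ x)) →
  ℋ′ k H → ℋ′ k G
ℋ′-contract {k} {H} {G} μ full H∈ℋ G′ ι ℓ approx A {X} {F} c A⊆X δ 0<δ = cases (nonempty? A)
  where
  open _IsMinorOf_ μ using (edge; edge-injective)
  Goal : Set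
  Goal = ∃₂ λ Y K → ConnectedSubgraph G Y K × A ⊆ Y × Eventually (λ m →
    sumOver (lengthAt (restrict ι ℓ) m) K ℚ.≤ sumOver (lengthAt ℓ m) F ℚ.+ δ)
  module _ (x₀ : V G) {η P : ℚ} (0<η : 0ℚ ℚ.< η) (0<P : 0ℚ ℚ.< P)
    (ΣP≤ : P ℚ.+ sumOver {#E G′} (λ _ → P) ⊤ ℚ.≤ ½ ℚ.* δ) (Ση≤P : sumOver {#E H} (λ _ → η) ⊤ ℚ.≤ P) where
    open Contraction {H} {G} μ full x₀
    open Gluing ι ℓ 0<η 0<P Ση≤P
    open Lift c
    A⊆X′ : ∀ {u} → u ∈ image root A → inlᵛ u ∈ X′
    A⊆X′ u∈ with ∈-image⁻ root A u∈
    ... | a , a∈A , refl = x∈p∪q⁺ (inj₁ (subst (_∈ image rep X) (rep-ι a) (∈-image⁺ rep (A⊆X a∈A))))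
    estimate : ∀ K m → (∀ i → 0ℚ ℚ.≤ lengthAt ℓ′ m i) × (∀ f → 0ℚ ℚ.≤ lengthAt ℓ m f) →
      sumOver (wᴴ m) K ℚ.≤ sumOver (lengthAt ℓ′ m) F′ ℚ.+ ½ ℚ.* δ →
      sumOver (lengthAt (restrict ι ℓ) m) (preimage edge K) ℚ.≤ sumOver (lengthAt ℓ m) F ℚ.+ δ
    estimate K m (w′≥0 , w≥0) K≤F′ = begin
      sumOver (lengthAt (restrict ι ℓ) m) (preimage edge K)
        ≤⟨ sumOver-preimage {w = wᴴ m} (w′≥0 ∘ inlᵉ) edge edge-injective (λ e → sym (wᴴ-edge m e)) K ⟩
      sumOver (wᴴ m) K                                     ≤⟨ K≤F′ ⟩
      sumOver (lengthAt ℓ′ m) F′ ℚ.+ ½ ℚ.* δ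
        ≤⟨ ℚₚ.+-monoˡ-≤ (½ ℚ.* δ) (ℚₚ.≤-trans (lift-sum m w′≥0 w≥0) (ℚₚ.+-monoʳ-≤ s ΣP≤)) ⟩
      s ℚ.+ ½ ℚ.* δ ℚ.+ ½ ℚ.* δ                            ≡⟨ +half+half s δ ⟩
      s ℚ.+ δ                                              ∎
      where
      open ℚₚ.≤-Reasoning
      s = sumOver (lengthAt ℓ m) F
    finish : (∃₂ λ Z K → ConnectedSubgraph H Z K × image root A ⊆ Z × Eventually (λ m →
      sumOver (wᴴ m) K ℚ.≤ sumOver (lengthAt ℓ′ m) F′ ℚ.+ ½ ℚ.* δ)) → Goal
    finish (Z , K , c′ , A⊆Z , K≲F′) = image collapse Z , preimage edge K , collapse-subgraph c′ ,
      (λ {a} a∈A → subst (_∈ image collapse Z) (collapse-branch (root∈ a))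
        (∈-image⁺ collapse (A⊆Z (∈-image⁺ root a∈A)))) ,
      eventually-zip (estimate K) nonneg K≲F′
    approximation : Goal
    approximation = finish (H∈ℋ H′ H↪H′ ℓ′ (approximable approx) (image root A)
      lift-connected A⊆X′ (½ ℚ.* δ) (half-positive 0<δ))
  choose : V G → (∃ λ P → 0ℚ ℚ.< P × P ℚ.+ sumOver {#E G′} (λ _ → P) ⊤ ℚ.≤ ½ ℚ.* δ) → Goal
  choose x₀ (P , 0<P , ΣP≤) with small-weight (#E H) 0<P
  ... | η , 0<η , Ση≤P = approximation x₀ 0<η 0<P ΣP≤ Ση≤P
  cases : Dec (Nonempty A) → Goal
  -- `G` might have no vertex to serve as `x₀`, but the empty set falls under the hypothesis for
  -- sizes up to `k`.
  cases (no empty) = approx A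
    (subst (_≤ k) (sym (trans (cong ∣_∣ (Empty-unique empty)) (∣⊥∣≡0 (#V G)))) ℕ.z≤n) c A⊆X δ 0<δ
  -- The successor accounts for the additional P spent on inner edges.
  cases (yes (x₀ , _)) = choose x₀ (small-weight (ℕ.suc (#E G′)) (half-positive 0<δ))

-- Arbitrary minors, by induction on the number of edges

-- Edges are deleted one by one until each remaining one is an edge of `G` or lies in a branch set.
-- Spelling out the components of the larger graph makes the recursion structural in `n`.
ℋ′-minor : ∀ {k G} n {v} (e₁ e₂ : Fin n → Fin v) (e₁≢e₂ : ∀ g → e₁ g ≢ e₂ g) →
  let H = record { #V = v ; #E = n ; end₁ = e₁ ; end₂ = e₂ ; loopless = e₁≢e₂ } in
  ℋ′ k H → G IsMinorOf H → ℋ′ k G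
ℋ′-minor ℕ.zero e₁ e₂ e₁≢e₂ H∈ℋ μ = ℋ′-contract μ (λ ()) H∈ℋ
ℋ′-minor {k} {G} (ℕ.suc n) {v} e₁ e₂ e₁≢e₂ H∈ℋ μ = cases (any? (¬? ∘ needed?))
  where
  open _IsMinorOf_ μ
  H : Graph
  H = record { #V = v ; #E = ℕ.suc n ; end₁ = e₁ ; end₂ = e₂ ; loopless = e₁≢e₂ }
  Needed : Fin (ℕ.suc n) → Set
  Needed g = (∃ λ e → edge e ≡ g) ⊎ ∃ λ x → g ∈ inducedEdges H (branch x)
  needed? : Decidable Needed
  needed? g = any? (λ e → edge e ≟ g) ⊎-dec any? (λ x → g ∈? inducedEdges H (branch x))
  cases : Dec (∃ λ g → ¬ Needed g) → ℋ′ k G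
  cases (no ¬deletable) = ℋ′-contract μ
    (λ g → decidable-stable (needed? g) (λ ¬n → ¬deletable (g , ¬n))) H∈ℋ
  cases (yes (g , ¬needed)) = ℋ′-minor n (e₁ ∘ punchIn g) (e₂ ∘ punchIn g) (e₁≢e₂ ∘ punchIn g)
    (ℋ′-delete H∈ℋ) μ′
    where
    open EdgeDeletion e₁ e₂ e₁≢e₂ g using (D; ℋ′-delete)
    g≢edge : ∀ e → g ≢ edge e
    g≢edge e eq = ¬needed (inj₁ (e , sym eq))
    -- The edge `g` is not induced by any branch set, so the walks inside branch sets survive its
    -- deletion.
    walk : ∀ x {a b} → Star (Adjacent H (inducedEdges H (branch x))) a b →
      Star (Adjacent D (inducedEdges D (branch x))) a b
    walk x = Star.map step
      where
      step : ∀ {a b} → Adjacent H (inducedEdges H (branch x)) a b →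
        Adjacent D (inducedEdges D (branch x)) a b
      step (h , h∈ , j) with punchIn-cover g h
      ... | inj₁ refl       = ⊥-elim (¬needed (inj₂ (x , h∈)))
      ... | inj₂ (d , refl) = d , ∈-inducedEdges⁺ D (branch x) (∈-inducedEdges⁻ H (branch x) h∈) , j
    μ′ : G IsMinorOf D
    μ′ = record
      { branch         = branch
      ; disjoint       = disjoint
      ; connected      = λ x → proj₁ (connected x) ,
          λ a b a∈ b∈ → walk x (proj₂ (connected x) a b a∈ b∈)
      ; edge           = λ e → punchOut (g≢edge e)
      ; edge-injective = λ eq → edge-injective (punchOut-injective (g≢edge _) (g≢edge _) eq)
      ; edge-joins     = λ e → let u , w , u∈ , w∈ , j = edge-joins e in
          u , w , u∈ , w∈ , subst (λ h → Joins H h u w) (sym (punchIn-punchOut (g≢edge e))) j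
      }

theorem6p1 : (k : ℕ) → 2 ≤ k → (H G : Graph) → ℋ k H → G IsMinorOf H → ℋ k G
theorem6p1 k _ H G H∈ℋ μ =
  ℋ′⇒ℋ (ℋ′-minor (#E H) (end₁ H) (end₂ H) (loopless H) (ℋ⇒ℋ′ H∈ℋ) μ)
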